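{- Let $n \geq 8$ be even, let $\omega_n := (1, 3, \ldots, n-1, n, n-2, \ldots, 2)$ be the cyclic order on $\{1,\ldots,n\}$ listing the odd numbers increasingly and then the even numbers decreasingly, and let $c_n$ be the edge-coloring of $C(n,\{2,3\})$ with colors red, black, purple, blue, green defined in the context. Then $(C(n,\{2,3\}),\omega_n,c_n)$ is a nearly dispersable matching book embedding.
   Context: All graphs are finite and simple. For a set $S=\{i_1<\cdots<i_k\}$ of integers with $k\ge 1$, $1\le i_1$ and $i_k\le \lfloor n/2\rfloor$, the circulant $C(n,S)$ is the graph on vertex set $\{1,\ldots,n\}$ in which each $j$ is adjacent to $j+i_r$ (addition mod $n$) for $r=1,\ldots,k$. Given a graph $G$ and a cyclic order $\omega$ on $V(G)$, draw the vertices on a circle in the order $\omega$ and the edges as straight chords; two edges cross if they intersect at a point that is not an endpoint. A matching book embedding $(G,\omega,c)$ consists of $G$, a cyclic order $\omega$, and an edge-coloring $c$ (the color classes are the pages) such that any two distinct edges of the same color neither cross nor share an endpoint. The embedding is nearly dispersable if the number of colors equals $1+\Delta(G)$, where $\Delta(G)$ is the maximum degree. The coloring $c_n$ ($n\ge 8$ even), writing $u{ - }v$ for the edge joining $u$ and $v$: The edges of the Hamiltonian path $(n-3, n-5, \ldots, 1, n-1, 2, n, n-2, \ldots, 4)$ (odd numbers from $n-3$ down to $1$, then $n-1$, then $2$, then even numbers from $n$ down to $4$) are colored alternatingly red and black along the path (starting with either color). Purple: $2{ - }5$, $4{ - }7$, $\ldots$, $(n-4){ - }(n-1)$, i.e.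 $a{ - }(a+3)$ for even $a$ with $2\le a\le n-4$. Blue: $1{ - }4$, $3{ - }6$, $\ldots$, $(n-3){ - }n$, i.e. $a{ - }(a+3)$ for odd $a$ with $1\le a\le n-3$. Green: $2{ - }4$, $(n-3){ - }(n-1)$, $3{ - }n$, $1{ - }(n-2)$. -}

module Defs where

open import Data.Bool using (Bool; if_then_else_)
open import Data.Fin using (Fin; toℕ; _≟_)
open import Data.Integer using (+_) renaming (_-_ to _-ℤ_)
open import Data.List using (List; []; _∷_; _++_; map; length; filter; reverse; allFin; applyUpTo; applyDownFrom)
open import Data.List.Extrema.Nat using (max)
open import Data.List.Membership.Propositional using (_∈_)
open import Data.List.Relation.Binary.Permutation.Propositional using (_↭_)
open import Data.List.Relation.Unary.All using (All; []; _∷_)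
open import Data.List.Relation.Unary.Any as Any using (Any; here; there; any?)
open import Data.List.Relation.Unary.Linked using (Linked; [-]; _∷_)
open import Data.List.Relation.Unary.Unique.Propositional using (Unique)
open import Data.Nat using (ℕ; suc; _+_; _*_; _∸_; _≤_; _<_; z≤n; s≤s; ⌊_/2⌋; ∣_-_∣)
open import Data.Nat.Divisibility using (_∣_; _∣?_; ∣⇒≤)
open import Data.Nat.Properties using (≤-trans; ⌊n/2⌋-mono; ⌊n/2⌋<n; <⇒≱; ∣m-m+n∣≡n; ∣-∣-comm)
open import Data.Product using (_×_; _,_; ∃; ∃₂; ∃!)
open import Data.Rational as ℚ using (ℚ; 0ℚ; 1ℚ)
open import Data.Sum using (_⊎_; inj₁; inj₂; [_,_]; swap)
open import Function using (_∘_; _⇔_)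
open import Relation.Binary.PropositionalEquality using (_≡_; _≢_; trans; subst)
open import Relation.Nullary using (¬_; Dec; yes; no; ¬?; _⊎-dec_)

record Graph (n : ℕ) : Set₁ where
  field
    Adj    : Fin n → Fin n → Set
    adj?   : ∀ u v → Dec (Adj u v)
    symm   : ∀ {u v} → Adj u v → Adj v u
    irrefl : ∀ {v} → ¬ Adj v v

  degree : Fin n → ℕ
  degree v = length (filter (adj? v) (allFin n))

  maxDegree : ℕ
  maxDegree = max 0 (map degree (allFin n))

-- The vertex set {1,…,n} is represented by Fin n, with v standing for the number label v.
label : ∀ {n} → Fin n → ℕ
label v = suc (toℕ v)

_≡_[mod_] : ℕ → ℕ → ℕ → Set
a ≡ b [mod n ] = n ∣ ∣ a - b ∣

record IsConnectionSet (n : ℕ) (S : List ℕ) : Set where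
  field
    nonEmpty   : 1 ≤ length S
    increasing : Linked _<_ S
    inRange    : All (λ i → 1 ≤ i × i ≤ ⌊ n /2⌋) S

module _ (n : ℕ) (S : List ℕ) where

  Step : Fin n → Fin n → ℕ → Set
  Step u v i = (label u + i) ≡ label v [mod n ]

  CirculantAdj : Fin n → Fin n → Set
  CirculantAdj u v = Any (λ i → Step u v i ⊎ Step v u i) S

  circulant : IsConnectionSet n S → Graph n
  circulant ok = record
    { Adj    = CirculantAdj
    ; adj?   = λ u v → any? (λ i → (n ∣? _) ⊎-dec (n ∣? _)) S
    ; symm   = Any.map swap
    ; irrefl = λ {v} → noLoop v (IsConnectionSet.inRange ok)
    }
    where
    n∤i : ∀ {m i} → 1 ≤ i → i ≤ ⌊ m /2⌋ → ¬ (m ∣ i)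
    n∤i {suc m} {suc i} _ i≤ m∣i = <⇒≱ (⌊n/2⌋<n m) (≤-trans (∣⇒≤ m∣i) i≤)

    noLoop : ∀ v {T} → All (λ i → 1 ≤ i × i ≤ ⌊ n /2⌋) T →
             ¬ Any (λ i → Step v v i ⊎ Step v v i) T
    noLoop v {i ∷ _} ((1≤i , i≤) ∷ _) (here e) = [ bad , bad ] e
      where
      bad : ¬ Step v v i
      bad d = n∤i 1≤i i≤ (subst (n ∣_) (dist (label v)) d)
        where
        dist : ∀ a → ∣ a + i - a ∣ ≡ i
        dist a = trans (∣-∣-comm (a + i) a) (∣m-m+n∣≡n a i)
    noLoop v (_ ∷ r) (there e) = noLoop v r e

-- Points of the plane with rational coordinates. If two distinct lines through
-- rational points meet, they meet in a rational point, so nothing is lost by working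
-- over ℚ instead of ℝ.
Point : Set
Point = ℚ × ℚ

-- The point of the unit circle at angle 2 arctan k.  These angles increase with k
-- and lie in [0,π), so place 0, place 1, place 2, … follow one another
-- counterclockwise.
place : ℕ → Point
place k = (+ 1 -ℤ + (k * k)) ℚ./ suc (k * k) , + (2 * k) ℚ./ suc (k * k)

between : Point → Point → ℚ → Point
between (x , y) (x′ , y′) t =
  (1ℚ ℚ.- t) ℚ.* x ℚ.+ t ℚ.* x′ , (1ℚ ℚ.- t) ℚ.* y ℚ.+ t ℚ.* y′

OnChord : Point → Point → Point → Set
OnChord P Q X = ∃ λ t → 0ℚ ℚ.≤ t × t ℚ.≤ 1ℚ × X ≡ between P Q t

-- A cyclic order is given by a list of the vertices, read cyclically. The first entry
-- is drawn at place 0; starting the list elsewhere would only move the vertices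
-- to other points of the circle, without changing which chords cross.
position : ∀ {n} → List (Fin n) → Fin n → ℕ
position []      v = 0
position (x ∷ ω) v with x ≟ v
... | yes _ = 0
... | no  _ = suc (position ω v)

Cross : ∀ {n} → List (Fin n) → (u v u′ v′ : Fin n) → Set
Cross ω u v u′ v′ = ∃ λ X →
  OnChord (draw u) (draw v) X × OnChord (draw u′) (draw v′) X ×
  X ≢ draw u × X ≢ draw v × X ≢ draw u′ × X ≢ draw v′
  where
  draw : Fin _ → Point
  draw = place ∘ position ω

SameEdge : ∀ {n} → (u v u′ v′ : Fin n) → Set
SameEdge u v u′ v′ = (u ≡ u′ × v ≡ v′) ⊎ (u ≡ v′ × v ≡ u′)

ShareEndpoint : ∀ {n} → (u v u′ v′ : Fin n) → Set
ShareEndpoint u v u′ v′ = (u ≡ u′ ⊎ u ≡ v′) ⊎ (v ≡ u′ ⊎ v ≡ v′)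

-- An assignment of colors to unordered pairs is given by its graph:
-- c x u v means that u−v is an edge and has color x.
Coloring : ℕ → Set → Set₁
Coloring n K = K → Fin n → Fin n → Set

record IsEdgeColoring {n K} (G : Graph n) (c : Coloring n K) : Set where
  open Graph G
  field
    onEdges    : ∀ {x u v} → c x u v → Adj u v
    undirected : ∀ {x u v} → c x u v → c x v u
    oneColor   : ∀ {u v} → Adj u v → ∃! _≡_ (λ x → c x u v)

record IsMatchingBookEmbedding {n K} (G : Graph n) (ω : List (Fin n)) (c : Coloring n K) : Set where
  field
    cyclicOrder  : ω ↭ allFin n
    edgeColoring : IsEdgeColoring G c
    noCrossing   : ∀ {x u v u′ v′} → c x u v → c x u′ v′ →
                   ¬ SameEdge u v u′ v′ → ¬ Cross ω u v u′ v′
    matching     : ∀ {x u v u′ v′} → c x u v → c x u′ v′ →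
                   ¬ SameEdge u v u′ v′ → ¬ ShareEndpoint u v u′ v′

NumberOfColors : ∀ {n K} → Coloring n K → ℕ → Set
NumberOfColors {K = K} c k = ∃ λ (xs : List K) →
  Unique xs × (∀ x → x ∈ xs ⇔ ∃₂ (c x)) × length xs ≡ k

record IsNearlyDispersable {n K} (G : Graph n) (ω : List (Fin n)) (c : Coloring n K) : Set where
  field
    matchingBookEmbedding : IsMatchingBookEmbedding G ω c
    numberOfColors        : NumberOfColors c (1 + Graph.maxDegree G)

C[_,2-3] : (n : ℕ) → 8 ≤ n → Graph n
C[ n ,2-3] 8≤n = circulant n (2 ∷ 3 ∷ []) record
  { nonEmpty   = s≤s z≤n
  ; increasing = s≤s (s≤s (s≤s z≤n)) ∷ [-]
  ; inRange    = (s≤s z≤n , ≤-trans (s≤s (s≤s z≤n)) 4≤n/2)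
               ∷ (s≤s z≤n , ≤-trans (s≤s (s≤s (s≤s z≤n))) 4≤n/2)
               ∷ []
  }
  where
  4≤n/2 : 4 ≤ ⌊ n /2⌋
  4≤n/2 = ⌊n/2⌋-mono 8≤n

ω : (n : ℕ) → List (Fin n)
ω n = filter (λ v → ¬? (2 ∣? label v)) (allFin n)
   ++ reverse (filter (λ v → 2 ∣? label v) (allFin n))

data Color : Set where
  red black purple blue green : Color

-- For n even, the two families are n-3, n-5, …, 1 and n, n-2, …, 4.
hamiltonianPath : ℕ → List ℕ
hamiltonianPath n =
  applyDownFrom (λ i → 1 + 2 * i) (⌊ n /2⌋ ∸ 1)
  ++ (n ∸ 1) ∷ 2 ∷ applyDownFrom (λ i → 4 + 2 * i) (⌊ n /2⌋ ∸ 1)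

alternating : Color → Color → List ℕ → List (Color × ℕ × ℕ)
alternating x y (a ∷ b ∷ as) = (x , a , b) ∷ alternating y x (b ∷ as)
alternating x y _            = []

-- For n even, the purple a are 2, 4, …, n-4 and the blue a are 1, 3, …, n-3.
coloredEdges : (n : ℕ) (redFirst : Bool) → List (Color × ℕ × ℕ)
coloredEdges n redFirst =
  (if redFirst then alternating red black (hamiltonianPath n)
               else alternating black red (hamiltonianPath n))
  ++ applyUpTo (λ i → let a = 2 + 2 * i in purple , a , a + 3) (⌊ n /2⌋ ∸ 2)
  ++ applyUpTo (λ i → let a = 1 + 2 * i in blue , a , a + 3) (⌊ n /2⌋ ∸ 1)
  ++ (green , 2 , 4) ∷ (green , n ∸ 3 , n ∸ 1) ∷ (green , 3 , n) ∷ (green , 1 , n ∸ 2) ∷ []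

c : (n : ℕ) (redFirst : Bool) → Coloring n Color
c n redFirst x u v = (x , label u , label v) ∈ coloredEdges n redFirst
                   ⊎ (x , label v , label u) ∈ coloredEdges n redFirst

{-# OPTIONS --safe #-}

-- Two chords of a circle do not meet if the ends of one lie strictly on the same side of the line
-- through the ends of the other. In the order ω the purple edges are nested, and so are the blue
-- ones; the green edges 3-n and 1-(n-2) are nested and the other two join neighbors on the circle.
-- For the path, all vertices that come after an edge lie on one side of it, so the edge can only
-- touch the edge directly after it, which has the other color. Each vertex has at most one
-- neighbor at each of the offsets ±2, ±3, and vertex 4 has four distinct ones, so Δ = 4.
module Submission where

open import Data.Bool using (Bool; true; false; if_then_else_)
open import Data.Fin as Fin using (Fin; zero; suc; toℕ; fromℕ<; _≟_)
import Data.Fin.Properties as Fin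
open import Data.Integer as ℤ using () renaming (+_ to pos)
import Data.Integer.Properties as ℤ
open import Data.List
  using (List; []; _∷_; _++_; map; applyUpTo; applyDownFrom; allFin; filter; reverse; length; lookup)
open import Data.List.Extrema.Nat using (max≤v⁺; v≤max⁺)
open import Data.List.Membership.Propositional using (_∈_; lose)
open import Data.List.Membership.Propositional.Properties
  using (∈-++⁺ˡ; ∈-++⁺ʳ; ∈-applyUpTo⁺; ∈-map⁺; ∈-map⁻; ∈-allFin; ∈-filter⁺; ∈-filter⁻; ∈-lookup)
import Data.List.Membership.Setoid.Properties as Membership
open import Data.List.Properties using (++-identityʳ; map-++; map-applyUpTo; map-applyDownFrom; unfold-reverse)
open import Data.List.Relation.Binary.Permutation.Propositional using (_↭_; ↭-refl; ↭-sym; ↭-trans; prep)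
open import Data.List.Relation.Binary.Permutation.Propositional.Properties
  using (All-resp-↭; ∈-resp-↭; ↭-reverse; ++⁺ˡ; shift)
open import Data.List.Relation.Unary.All as All using (All; []; _∷_)
import Data.List.Relation.Unary.All.Properties as All
open import Data.List.Relation.Unary.AllPairs as AllPairs using (AllPairs; []; _∷_)
import Data.List.Relation.Unary.AllPairs.Properties as AllPairs
open import Data.List.Relation.Unary.Any as Any using (Any; here; there)
import Data.List.Relation.Unary.Any.Properties as Any
open import Data.List.Relation.Unary.Unique.Propositional using (Unique)
import Data.List.Relation.Unary.Unique.Propositional.Properties as Unique
open import Data.Nat as ℕ using (ℕ; zero; suc; _+_; _*_; _∸_; _≤_; _<_; z≤n; s≤s; z<s; s<s; ⌊_/2⌋; ∣_-_∣)
open import Data.Nat.Divisibility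
  using (_∣_; _∣?_; divides; ∣-refl; _∣0; ∣m+n∣m⇒∣n; n∣m*n; >⇒∤; ∣1⇒≡1)
import Data.Nat.Properties as ℕ
open import Data.Product as Product using (_×_; _,_; proj₁; proj₂; ∃; ∃₂; ∃!; map₂)
open import Data.Rational as ℚ using (ℚ; 0ℚ; 1ℚ; _/_)
import Data.Rational.Properties as ℚ
import Data.Rational.Solver as ℚ-Solver
open import Data.Rational.Unnormalised as ℚᵘ using (mkℚᵘ; *≡*)
import Data.Rational.Unnormalised.Properties as ℚᵘ
open import Data.Sum as Sum using (_⊎_; inj₁; inj₂)
open import Function using (_∘_; flip; id; mk⇔)
open import Relation.Binary.PropositionalEquality
open import Relation.Nullary using (¬_; ¬?; contradiction; yes; no)
open import Relation.Unary using (Decidable)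
open import Defs

-- Chord crossing

-- Crossing is defined by actual points of the plane, so it has to be excluded by rational
-- coordinates. All places lie at angles in [0,π), so the linear order of the places can stand for
-- the cyclic one, and the side of place k relative to the chord from p to q is the sign of (k -
-- p)(k - q). `SameSide` takes the order as a parameter because it is checked on the order `≺` of
-- the vertices, where each case compares two indices, and is then carried along `position` to
-- numbers.
--
-- Since the side condition is strict, it excludes crossings and common ends at once. All pairs of
-- listed edges are compared for distinctness, and those of equal color also for sides. Distinctness
-- gives the uniqueness of colors; their existence needs a separate classification of all steps by 2
-- and 3.
--
-- The other obstacle is addition mod n. Splitting the labels by parity and letting vertices run
-- beyond n turns a congruence into one of two equations between vertices, which pattern matching
-- can solve.

module _ {A : Set} (_<_ : A → A → Set) where
  Outside Inside : (p q r : A) → Set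
  Outside p q r = (r < p × r < q) ⊎ (p < r × q < r)
  Inside  p q r = (p < r × r < q) ⊎ (q < r × r < p)

  SameSide : (p q r s : A) → Set
  SameSide p q r s = (Outside p q r × Outside p q s) ⊎ (Inside p q r × Inside p q s)

-- The fraction `i / d` is reduced by a gcd that does not compute for variables. Sums and products
-- are therefore calculated on unnormalised fractions and transferred.
fromℚᵘ-homo-+ : ∀ p q → ℚ.fromℚᵘ (p ℚᵘ.+ q) ≡ ℚ.fromℚᵘ p ℚ.+ ℚ.fromℚᵘ q
fromℚᵘ-homo-+ p q = ℚ.toℚᵘ-injective (begin
  ℚ.toℚᵘ (ℚ.fromℚᵘ (p ℚᵘ.+ q))                       ≈⟨ ℚ.toℚᵘ-fromℚᵘ (p ℚᵘ.+ q) ⟩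
  p ℚᵘ.+ q                                           ≈⟨ ℚᵘ.+-cong (ℚ.toℚᵘ-fromℚᵘ p) (ℚ.toℚᵘ-fromℚᵘ q) ⟨
  ℚ.toℚᵘ (ℚ.fromℚᵘ p) ℚᵘ.+ ℚ.toℚᵘ (ℚ.fromℚᵘ q)       ≈⟨ ℚ.toℚᵘ-homo-+ (ℚ.fromℚᵘ p) (ℚ.fromℚᵘ q) ⟨
  ℚ.toℚᵘ (ℚ.fromℚᵘ p ℚ.+ ℚ.fromℚᵘ q)                 ∎)
  where open ℚᵘ.≃-Reasoning

fromℚᵘ-homo-* : ∀ p q → ℚ.fromℚᵘ (p ℚᵘ.* q) ≡ ℚ.fromℚᵘ p ℚ.* ℚ.fromℚᵘ q
fromℚᵘ-homo-* p q = ℚ.toℚᵘ-injective (begin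
  ℚ.toℚᵘ (ℚ.fromℚᵘ (p ℚᵘ.* q))                       ≈⟨ ℚ.toℚᵘ-fromℚᵘ (p ℚᵘ.* q) ⟩
  p ℚᵘ.* q                                           ≈⟨ ℚᵘ.*-cong (ℚ.toℚᵘ-fromℚᵘ p) (ℚ.toℚᵘ-fromℚᵘ q) ⟨
  ℚ.toℚᵘ (ℚ.fromℚᵘ p) ℚᵘ.* ℚ.toℚᵘ (ℚ.fromℚᵘ q)       ≈⟨ ℚ.toℚᵘ-homo-* (ℚ.fromℚᵘ p) (ℚ.fromℚᵘ q) ⟨
  ℚ.toℚᵘ (ℚ.fromℚᵘ p ℚ.* ℚ.fromℚᵘ q)                 ∎)
  where open ℚᵘ.≃-Reasoning

ι : ℕ → ℚ
ι k = pos k / 1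

/1-homo-+ : ∀ i j → (i ℤ.+ j) / 1 ≡ i / 1 ℚ.+ j / 1
/1-homo-+ i j = trans
  (ℚ.fromℚᵘ-cong {mkℚᵘ (i ℤ.+ j) 0} {mkℚᵘ i 0 ℚᵘ.+ mkℚᵘ j 0}
    (*≡* (cong (ℤ._* pos 1) (cong₂ ℤ._+_ (sym (ℤ.*-identityʳ i)) (sym (ℤ.*-identityʳ j))))))
  (fromℚᵘ-homo-+ (mkℚᵘ i 0) (mkℚᵘ j 0))

ι-* : ∀ a b → ι (a * b) ≡ ι a ℚ.* ι b
ι-* a b = trans (cong (_/ 1) (ℤ.pos-* a b)) (fromℚᵘ-homo-* (mkℚᵘ (pos a) 0) (mkℚᵘ (pos b) 0))

ι-mono-< : ∀ {a b} → a < b → ι a ℚ.< ι b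
ι-mono-< {a} {b} a<b = ℚ.toℚᵘ-cancel-< (ℚᵘ.<-respˡ-≃ (ℚᵘ.≃-sym (ℚ.toℚᵘ-fromℚᵘ (mkℚᵘ (pos a) 0)))
  (ℚᵘ.<-respʳ-≃ (ℚᵘ.≃-sym (ℚ.toℚᵘ-fromℚᵘ (mkℚᵘ (pos b) 0)))
    (ℚᵘ.*<* (ℤ.*-monoʳ-<-pos (pos 1) (ℤ.+<+ a<b)))))

-/1 : ∀ a b → (pos a ℤ.- pos b) / 1 ≡ ι a ℚ.- ι b
-/1 a b = begin
  (pos a ℤ.- pos b) / 1
    ≡⟨ solve 2 (λ x y → x := (x :+ y) :- y) refl ((pos a ℤ.- pos b) / 1) (ι b) ⟩
  ((pos a ℤ.- pos b) / 1 ℚ.+ ι b) ℚ.- ι b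
    ≡⟨ cong (ℚ._- ι b) (/1-homo-+ (pos a ℤ.- pos b) (pos b)) ⟨
  (pos a ℤ.- pos b ℤ.+ pos b) / 1 ℚ.- ι b
    ≡⟨ cong (λ i → i / 1 ℚ.- ι b) (cancel (pos a) (pos b)) ⟩
  ι a ℚ.- ι b ∎
  where
  open ≡-Reasoning
  open ℚ-Solver.+-*-Solver
  cancel : ∀ i j → i ℤ.- j ℤ.+ j ≡ i
  cancel i j = trans (ℤ.+-assoc i (ℤ.- j) j)
                     (trans (cong (λ k → i ℤ.+ k) (ℤ.+-inverseˡ j)) (ℤ.+-identityʳ i))

/-cancel : ∀ i d → i / suc d ℚ.* ι (suc d) ≡ i / 1
/-cancel i d = trans (sym (fromℚᵘ-homo-* (mkℚᵘ i d) (mkℚᵘ (pos (suc d)) 0)))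
  (ℚ.fromℚᵘ-cong {mkℚᵘ i d ℚᵘ.* mkℚᵘ (pos (suc d)) 0} {mkℚᵘ i 0}
    (*≡* (trans (ℤ.*-identityʳ _) (cong (λ e → i ℤ.* pos (suc e)) (sym (ℕ.*-identityʳ d))))))

-- An affine function whose value at place k is 2 (k - p) (k - q) / (1 + k²). It vanishes at place p
-- and place q, so on the line through them.
side : ℕ → ℕ → Point → ℚ
side p q (x , y) = (1ℚ ℚ.- x) ℚ.- (ι p ℚ.+ ι q) ℚ.* y ℚ.+ ι p ℚ.* ι q ℚ.* (1ℚ ℚ.+ x)

side-between : ∀ p q A B t →
  side p q (between A B t) ≡ (1ℚ ℚ.- t) ℚ.* side p q A ℚ.+ t ℚ.* side p q B
side-between p q (x , y) (x′ , y′) t =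
  solve 7 (λ p q x y x′ y′ t →
    let one = con 1ℚ
        f = λ x y → (one :- x) :- (p :+ q) :* y :+ p :* q :* (one :+ x) in
    f ((one :- t) :* x :+ t :* x′) ((one :- t) :* y :+ t :* y′)
      := (one :- t) :* f x y :+ t :* f x′ y′)
    refl (ι p) (ι q) x y x′ y′ t
  where open ℚ-Solver.+-*-Solver

-- The denominator D = 1 + k² is cleared: from xD = 1 - k² and yD = 2k the left side becomes 2k² -
-- 2(p + q)k + 2pq.
side-place : ∀ p q k →
  side p q (place k) ℚ.* ι (suc (k * k)) ≡ ι 2 ℚ.* ((ι k ℚ.- ι p) ℚ.* (ι k ℚ.- ι q))
side-place p q k = begin
  side p q (x , y) ℚ.* D
    ≡⟨ solve 5 (λ p q x y d →
         let one = con 1ℚ in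
         ((one :- x) :- (p :+ q) :* y :+ p :* q :* (one :+ x)) :* d
           := (d :- x :* d) :- (p :+ q) :* (y :* d) :+ p :* q :* (d :+ x :* d))
         refl (ι p) (ι q) x y D ⟩
  (D ℚ.- x ℚ.* D) ℚ.- (ι p ℚ.+ ι q) ℚ.* (y ℚ.* D) ℚ.+ ι p ℚ.* ι q ℚ.* (D ℚ.+ x ℚ.* D)
    ≡⟨ cong₂ (λ X Y → (D ℚ.- X) ℚ.- (ι p ℚ.+ ι q) ℚ.* Y ℚ.+ ι p ℚ.* ι q ℚ.* (D ℚ.+ X)) xD yD ⟩
  (D ℚ.- (1ℚ ℚ.- K²)) ℚ.- (ι p ℚ.+ ι q) ℚ.* (ι 2 ℚ.* ι k) ℚ.+ ι p ℚ.* ι q ℚ.* (D ℚ.+ (1ℚ ℚ.- K²))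
    ≡⟨ cong (λ d → (d ℚ.- (1ℚ ℚ.- K²)) ℚ.- (ι p ℚ.+ ι q) ℚ.* (ι 2 ℚ.* ι k)
                   ℚ.+ ι p ℚ.* ι q ℚ.* (d ℚ.+ (1ℚ ℚ.- K²))) D≡ ⟩
  ((1ℚ ℚ.+ K²) ℚ.- (1ℚ ℚ.- K²)) ℚ.- (ι p ℚ.+ ι q) ℚ.* (ι 2 ℚ.* ι k)
    ℚ.+ ι p ℚ.* ι q ℚ.* ((1ℚ ℚ.+ K²) ℚ.+ (1ℚ ℚ.- K²))
    ≡⟨ solve 3 (λ p q k →
         let one = con 1ℚ; two = con (ι 2) in
         ((one :+ k :* k) :- (one :- k :* k)) :- (p :+ q) :* (two :* k)
           :+ p :* q :* ((one :+ k :* k) :+ (one :- k :* k))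
           := two :* ((k :- p) :* (k :- q)))
         refl (ι p) (ι q) (ι k) ⟩
  ι 2 ℚ.* ((ι k ℚ.- ι p) ℚ.* (ι k ℚ.- ι q)) ∎
  where
  open ≡-Reasoning
  open ℚ-Solver.+-*-Solver
  x  = proj₁ (place k)
  y  = proj₂ (place k)
  D  = ι (suc (k * k))
  K² = ι k ℚ.* ι k
  D≡ : D ≡ 1ℚ ℚ.+ K²
  D≡ = trans (/1-homo-+ (pos 1) (pos (k * k))) (cong (1ℚ ℚ.+_) (ι-* k k))
  xD : x ℚ.* D ≡ 1ℚ ℚ.- K²
  xD = trans (/-cancel (pos 1 ℤ.- pos (k * k)) (k * k))
             (trans (-/1 1 (k * k)) (cong (λ z → 1ℚ ℚ.- z) (ι-* k k)))
  yD : y ℚ.* D ≡ ι 2 ℚ.* ι k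
  yD = trans (/-cancel (pos (2 * k)) (k * k)) (ι-* 2 k)

0<-⇒ : ∀ {a b} → a ℚ.< b → 0ℚ ℚ.< b ℚ.- a
0<-⇒ {a} {b} a<b = subst (ℚ._< b ℚ.- a) (ℚ.+-inverseʳ a) (ℚ.+-monoˡ-< (ℚ.- a) a<b)

0<* : ∀ {a b} → 0ℚ ℚ.< a → 0ℚ ℚ.< b → 0ℚ ℚ.< a ℚ.* b
0<* {a} {b} 0<a 0<b = ℚ.positive⁻¹ (a ℚ.* b)
  where instance
    _ = ℚ.positive 0<a
    _ = ℚ.positive 0<b
    _ = ℚ.pos*pos⇒pos a b

ι-cancel-pos : ∀ k {a} → 0ℚ ℚ.< a ℚ.* ι (suc (k * k)) → 0ℚ ℚ.< a
ι-cancel-pos k {a} 0<aD = ℚ.*-cancelʳ-<-nonNeg D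
  {{ℚ.nonNegative (ℚ.<⇒≤ (ι-mono-< {0} {suc (k * k)} z<s))}}
  (subst (ℚ._< a ℚ.* D) (sym (ℚ.*-zeroˡ D)) 0<aD)
  where D = ι (suc (k * k))

0<side : ∀ {p q k} → Outside _<_ p q k → 0ℚ ℚ.< side p q (place k)
0<side {p} {q} {k} o = ι-cancel-pos k (subst (0ℚ ℚ.<_) (sym (side-place p q k))
  (0<* (ι-mono-< {0} {2} z<s) (product o)))
  where
  open ℚ-Solver.+-*-Solver
  product : Outside _<_ p q k → 0ℚ ℚ.< (ι k ℚ.- ι p) ℚ.* (ι k ℚ.- ι q)
  product (inj₁ (k<p , k<q)) = subst (0ℚ ℚ.<_)
    (solve 3 (λ p q k → (p :- k) :* (q :- k) := (k :- p) :* (k :- q)) refl (ι p) (ι q) (ι k))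
    (0<* (0<-⇒ (ι-mono-< k<p)) (0<-⇒ (ι-mono-< k<q)))
  product (inj₂ (p<k , q<k)) = 0<* (0<-⇒ (ι-mono-< p<k)) (0<-⇒ (ι-mono-< q<k))

-- Between p and q the factors k - p and k - q have opposite signs. The sign is put into the
-- statement so that `convex-pos` serves both sides of a chord.
0<-side : ∀ {p q k} → Inside _<_ p q k → 0ℚ ℚ.< ℚ.- side p q (place k)
0<-side {p} {q} {k} i = ι-cancel-pos k (subst (0ℚ ℚ.<_) eq (0<* (ι-mono-< {0} {2} z<s) (product i)))
  where
  open ℚ-Solver.+-*-Solver
  product : Inside _<_ p q k → 0ℚ ℚ.< (ι k ℚ.- ι p) ℚ.* (ι q ℚ.- ι k)
  product (inj₁ (p<k , k<q)) = 0<* (0<-⇒ (ι-mono-< p<k)) (0<-⇒ (ι-mono-< k<q))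
  product (inj₂ (q<k , k<p)) = subst (0ℚ ℚ.<_)
    (solve 3 (λ p q k → (k :- q) :* (p :- k) := (k :- p) :* (q :- k)) refl (ι p) (ι q) (ι k))
    (0<* (0<-⇒ (ι-mono-< q<k)) (0<-⇒ (ι-mono-< k<p)))
  eq : ι 2 ℚ.* ((ι k ℚ.- ι p) ℚ.* (ι q ℚ.- ι k)) ≡ ℚ.- side p q (place k) ℚ.* ι (suc (k * k))
  eq = begin
    ι 2 ℚ.* ((ι k ℚ.- ι p) ℚ.* (ι q ℚ.- ι k))
      ≡⟨ solve 4 (λ p q k a → a :* ((k :- p) :* (q :- k)) := :- (a :* ((k :- p) :* (k :- q))))
           refl (ι p) (ι q) (ι k) (ι 2) ⟩
    ℚ.- (ι 2 ℚ.* ((ι k ℚ.- ι p) ℚ.* (ι k ℚ.- ι q)))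
      ≡⟨ cong ℚ.-_ (side-place p q k) ⟨
    ℚ.- (side p q (place k) ℚ.* ι (suc (k * k)))
      ≡⟨ ℚ.neg-distribˡ-* (side p q (place k)) (ι (suc (k * k))) ⟩
    ℚ.- side p q (place k) ℚ.* ι (suc (k * k)) ∎
    where open ≡-Reasoning

side-vanishes : ∀ p q k → (ι k ℚ.- ι p) ℚ.* (ι k ℚ.- ι q) ≡ 0ℚ → side p q (place k) ≡ 0ℚ
side-vanishes p q k z = ℚ.≤-antisym
  (ℚ.*-cancelʳ-≤-pos D (ℚ.≤-reflexive eq))
  (ℚ.*-cancelʳ-≤-pos D (ℚ.≤-reflexive (sym eq)))
  where
  D = ι (suc (k * k))
  instance _ = ℚ.positive (ι-mono-< {0} {suc (k * k)} z<s)
  eq : side p q (place k) ℚ.* D ≡ 0ℚ ℚ.* D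
  eq = trans (side-place p q k) (trans (cong (ι 2 ℚ.*_) z) (sym (ℚ.*-zeroˡ D)))

-- The two ends are the roots of (k - p)(k - q), and an affine function that vanishes at both ends
-- vanishes along the chord.
side-chord : ∀ p q {X} → OnChord (place p) (place q) X → side p q X ≡ 0ℚ
side-chord p q (t , _ , _ , refl) = begin
  side p q (between (place p) (place q) t)
    ≡⟨ side-between p q (place p) (place q) t ⟩
  (1ℚ ℚ.- t) ℚ.* side p q (place p) ℚ.+ t ℚ.* side p q (place q)
    ≡⟨ cong₂ (λ a b → (1ℚ ℚ.- t) ℚ.* a ℚ.+ t ℚ.* b)
         (side-vanishes p q p (solve 2 (λ p q → (p :- p) :* (p :- q) := con 0ℚ) refl (ι p) (ι q)))
         (side-vanishes p q q (solve 2 (λ p q → (q :- p) :* (q :- q) := con 0ℚ) refl (ι p) (ι q))) ⟩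
  (1ℚ ℚ.- t) ℚ.* 0ℚ ℚ.+ t ℚ.* 0ℚ
    ≡⟨ solve 1 (λ t → (con 1ℚ :- t) :* con 0ℚ :+ t :* con 0ℚ := con 0ℚ) refl t ⟩
  0ℚ ∎
  where
  open ≡-Reasoning
  open ℚ-Solver.+-*-Solver

0≤-⇒ : ∀ {a b} → a ℚ.≤ b → 0ℚ ℚ.≤ b ℚ.- a
0≤-⇒ {a} {b} a≤b = subst (ℚ._≤ b ℚ.- a) (ℚ.+-inverseʳ a) (ℚ.+-monoˡ-≤ (ℚ.- a) a≤b)

0≤* : ∀ {a b} → 0ℚ ℚ.≤ a → 0ℚ ℚ.≤ b → 0ℚ ℚ.≤ a ℚ.* b
0≤* {a} {b} 0≤a 0≤b = ℚ.nonNegative⁻¹ (a ℚ.* b)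
  {{ℚ.nonNeg*nonNeg⇒nonNeg a {{ℚ.nonNegative 0≤a}} b {{ℚ.nonNegative 0≤b}}}}

-- The combination is the smaller of the two values plus a nonnegative multiple of their difference.
-- Strictness comes from the first summand, so the end values of t need no case of their own.
convex-pos : ∀ {a b t} → 0ℚ ℚ.≤ t → t ℚ.≤ 1ℚ → 0ℚ ℚ.< a → 0ℚ ℚ.< b →
             0ℚ ℚ.< (1ℚ ℚ.- t) ℚ.* a ℚ.+ t ℚ.* b
convex-pos {a} {b} {t} 0≤t t≤1 0<a 0<b with ℚ.≤-total a b
... | inj₁ a≤b = subst (0ℚ ℚ.<_)
  (solve 3 (λ a b t → a :+ t :* (b :- a) := (con 1ℚ :- t) :* a :+ t :* b) refl a b t)
  (ℚ.+-mono-<-≤ 0<a (0≤* 0≤t (0≤-⇒ a≤b)))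
  where open ℚ-Solver.+-*-Solver
... | inj₂ b≤a = subst (0ℚ ℚ.<_)
  (solve 3 (λ a b t → b :+ (con 1ℚ :- t) :* (a :- b) := (con 1ℚ :- t) :* a :+ t :* b) refl a b t)
  (ℚ.+-mono-<-≤ 0<b (0≤* (0≤-⇒ t≤1) (0≤-⇒ b≤a)))
  where open ℚ-Solver.+-*-Solver

-- At a common point `side p q` would be zero because of the first chord and nonzero because of the
-- second. The chords are closed, so common ends are excluded too.
chords-disjoint : ∀ p q r s {X} → SameSide _<_ p q r s →
                  OnChord (place p) (place q) X → ¬ OnChord (place r) (place s) X
chords-disjoint p q r s (inj₁ (or , os)) pq (t , 0≤t , t≤1 , refl) =
  ℚ.<-irrefl (sym (side-chord p q pq))
    (subst (0ℚ ℚ.<_) (sym (side-between p q (place r) (place s) t))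
      (convex-pos 0≤t t≤1 (0<side or) (0<side os)))
chords-disjoint p q r s (inj₂ (ir , is)) pq (t , 0≤t , t≤1 , refl) =
  ℚ.<-irrefl (sym (cong ℚ.-_ (side-chord p q pq)))
    (subst (0ℚ ℚ.<_) eq (convex-pos 0≤t t≤1 (0<-side ir) (0<-side is)))
  where
  open ℚ-Solver.+-*-Solver
  eq : (1ℚ ℚ.- t) ℚ.* (ℚ.- side p q (place r)) ℚ.+ t ℚ.* (ℚ.- side p q (place s))
       ≡ ℚ.- side p q (between (place r) (place s) t)
  eq = trans
    (solve 3 (λ t a b → (con 1ℚ :- t) :* (:- a) :+ t :* (:- b) := :- ((con 1ℚ :- t) :* a :+ t :* b))
      refl t (side p q (place r)) (side p q (place s)))
    (cong ℚ.-_ (sym (side-between p q (place r) (place s) t)))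

-- The colored edges in ω-order

-- Separating the parities: a label is written 2i+1 or 2i+2. Throughout, n = 2(4 + m), so that the
-- vertices of the graph are the O i and E i with i < 4 + m.
data Vertex : Set where
  O E : ℕ → Vertex

-- With `i * 2` instead of `2 * i` the label of `O (suc i)` computes to 3 + i * 2, so `next` raises
-- labels by one definitionally.
num : Vertex → ℕ
num (O i) = 1 + i * 2
num (E i) = 2 + i * 2

-- The order in which ω lists the vertices.
data _≺_ : Vertex → Vertex → Set where
  O≺O : ∀ {i j} → i < j → O i ≺ O j
  O≺E : ∀ {i j} → O i ≺ E j
  E≺E : ∀ {i j} → j < i → E i ≺ E j

≺-irrefl : ∀ {p} → ¬ p ≺ p
≺-irrefl (O≺O i<i) = ℕ.<-irrefl refl i<i
≺-irrefl (E≺E i<i) = ℕ.<-irrefl refl i<i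

Same : {A : Set} (p q r s : A) → Set
Same p q r s = (p ≡ r × q ≡ s) ⊎ (p ≡ s × q ≡ r)

Edge : Set
Edge = Color × Vertex × Vertex

-- If r and s are on the same side of the chord pq then the two edges neither cross nor share an
-- endpoint.
Compatible : Edge → Edge → Set
Compatible (x , p , q) (y , r , s) = ¬ Same p q r s × (x ≡ y → SameSide _≺_ p q r s)

-- The side is chosen once for the whole list, so any two of its entries are on the same side.
SidedList : (p q : Vertex) → List Vertex → Set
SidedList p q rs = All (Outside _≺_ p q) rs ⊎ All (Inside _≺_ p q) rs

≢-outside : ∀ {p q r} → Outside _≺_ p q r → p ≢ r × q ≢ r
≢-outside (inj₁ (r<p , r<q)) = (λ { refl → ≺-irrefl r<p }) , (λ { refl → ≺-irrefl r<q })
≢-outside (inj₂ (p<r , q<r)) = (λ { refl → ≺-irrefl p<r }) , (λ { refl → ≺-irrefl q<r })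

≢-inside : ∀ {p q r} → Inside _≺_ p q r → p ≢ r × q ≢ r
≢-inside (inj₁ (p<r , r<q)) = (λ { refl → ≺-irrefl p<r }) , (λ { refl → ≺-irrefl r<q })
≢-inside (inj₂ (q<r , r<p)) = (λ { refl → ≺-irrefl r<p }) , (λ { refl → ≺-irrefl q<r })

sameSide⇒≢ : ∀ {p q r s} → SameSide _≺_ p q r s → (p ≢ r × q ≢ r) × (p ≢ s × q ≢ s)
sameSide⇒≢ (inj₁ (r , s)) = ≢-outside r , ≢-outside s
sameSide⇒≢ (inj₂ (r , s)) = ≢-inside r , ≢-inside s

sameSide⇒compatible : ∀ {x y p q r s} → SameSide _≺_ p q r s → Compatible (x , p , q) (y , r , s)
sameSide⇒compatible ss with sameSide⇒≢ ss
... | (p≢r , _) , (p≢s , _) = (λ { (inj₁ (p≡r , _)) → p≢r p≡r ; (inj₂ (p≡s , _)) → p≢s p≡s }) , λ _ → ss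

-- R relates each entry to its successor and to the list of all entries after that.
data Chain {A : Set} (R : A → A → List A → Set) : List A → Set where
  []  : Chain R []
  [-] : ∀ {a} → Chain R (a ∷ [])
  _∷_ : ∀ {a b as} → R a b as → Chain R (b ∷ as) → Chain R (a ∷ b ∷ as)

chain-downFrom : ∀ {A : Set} {R : A → A → List A → Set} {as} (f : ℕ → A) k →
  (∀ {i} → i < k → R (f (suc i)) (f i) (applyDownFrom f i ++ as)) →
  Chain R (f 0 ∷ as) → Chain R (applyDownFrom f (suc k) ++ as)
chain-downFrom f zero    Rf ch = ch
chain-downFrom f (suc k) Rf ch = Rf (ℕ.n<1+n k) ∷ chain-downFrom f k (Rf ∘ ℕ.m<n⇒m<1+n) ch

data Consecutive {A : Set} (a b : A) : List A → Set where
  here  : ∀ {as} → Consecutive a b (a ∷ b ∷ as)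
  there : ∀ {c as} → Consecutive a b as → Consecutive a b (c ∷ as)

consecutive-++ : ∀ {A : Set} {a b : A} as {bs} → Consecutive a b bs → Consecutive a b (as ++ bs)
consecutive-++ []       c = c
consecutive-++ (_ ∷ as) c = there (consecutive-++ as c)

consecutive-downFrom : ∀ {A : Set} (f : ℕ → A) {as i k} → i < k →
  Consecutive (f (suc i)) (f i) (applyDownFrom f (suc k) ++ as)
consecutive-downFrom f {i = i} {suc k} i<1+k with i ℕ.≟ k
... | yes refl = here
... | no  i≢k  = there (consecutive-downFrom f (ℕ.≤∧≢⇒< (ℕ.s≤s⁻¹ i<1+k) i≢k))

consecutive-last : ∀ {A : Set} (f : ℕ → A) {b as} k →
  Consecutive (f 0) b (applyDownFrom f (suc k) ++ b ∷ as)
consecutive-last f zero    = here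
consecutive-last f (suc k) = there (consecutive-last f k)

-- A polymorphic form of `alternating`, so that the path can be studied on vertices and translated
-- to labels at the end.
alternate : {A : Set} → Color → Color → List A → List (Color × A × A)
alternate x y (a ∷ b ∷ as) = (x , a , b) ∷ alternate y x (b ∷ as)
alternate x y _            = []

-- Which color appears depends on the parity of the place in the list. Existence is enough here,
-- since uniqueness comes from `compare`.
consecutive⇒alternate : ∀ {A : Set} {a b : A} {as} x y → Consecutive a b as →
  ∃ λ z → (z , a , b) ∈ alternate x y as
consecutive⇒alternate x y here = x , here refl
consecutive⇒alternate x y (there {as = _ ∷ _ ∷ _} c) = map₂ there (consecutive⇒alternate y x c)
consecutive⇒alternate x y (there {as = _ ∷ []} (there ()))

alternate-ends : ∀ {A : Set} {P : A → Set} {x y as} → All P as →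
  All (λ { (_ , a , b) → P a × P b }) (alternate x y as)
alternate-ends []           = []
alternate-ends (p ∷ [])     = []
alternate-ends (p ∷ q ∷ ps) = (p , q) ∷ alternate-ends (q ∷ ps)

alternate-colors : ∀ {A : Set} {P : Color → Set} {x y} (as : List A) → P x → P y →
  All (P ∘ proj₁) (alternate x y as)
alternate-colors []           px py = []
alternate-colors (_ ∷ [])     px py = []
alternate-colors (_ ∷ b ∷ as) px py = px ∷ alternate-colors (b ∷ as) py px

alternate-edges : ∀ {A : Set} {R : A → A → List A → Set} {P : A → A → Set} {x y as} →
  (∀ {a b bs} → R a b bs → P a b) → Chain R as →
  All (λ { (_ , a , b) → P a b }) (alternate x y as)
alternate-edges f []       = []
alternate-edges f [-]      = []
alternate-edges f (r ∷ rs) = f r ∷ alternate-edges f rs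

sided⇒compatible : ∀ {x p q y z rs} → SidedList p q rs → All (Compatible (x , p , q)) (alternate y z rs)
sided⇒compatible (inj₁ out) = All.map (sameSide⇒compatible ∘ inj₁) (alternate-ends out)
sided⇒compatible (inj₂ ins) = All.map (sameSide⇒compatible ∘ inj₂) (alternate-ends ins)

sided-head : ∀ {p q r rs} → SidedList p q (r ∷ rs) → p ≢ r × q ≢ r
sided-head (inj₁ (r ∷ _)) = ≢-outside r
sided-head (inj₂ (r ∷ _)) = ≢-inside r

chain⇒compatible : ∀ {x y ps} → x ≢ y → Chain SidedList ps → AllPairs Compatible (alternate x y ps)
chain⇒compatible x≢y []        = []
chain⇒compatible x≢y [-]       = []
chain⇒compatible x≢y (_ ∷ [-]) = [] ∷ []
chain⇒compatible x≢y (s ∷ ch@(_ ∷ _)) =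
  -- The next edge starts at q and so cannot satisfy a strict side condition. It differs from pq
  -- because its far end is neither p nor q.
  ((distinct (sided-head s) , flip contradiction x≢y) ∷ sided⇒compatible s)
  ∷ chain⇒compatible (x≢y ∘ sym) ch
  where
  distinct : ∀ {p q r : Vertex} → p ≢ r × q ≢ r → ¬ Same p q q r
  distinct (p≢r , q≢r) (inj₁ (_ , q≡r)) = q≢r q≡r
  distinct (p≢r , q≢r) (inj₂ (p≡r , _)) = p≢r p≡r

-- The edge list and its pairwise compatibility

data PathEdge (m : ℕ) : Vertex → Vertex → Set where
  oddStep  : ∀ {i} → i < 2 + m → PathEdge m (O (suc i)) (O i)
  left     : PathEdge m (O 0) (O (3 + m))
  diagonal : PathEdge m (O (3 + m)) (E 0)
  right    : PathEdge m (E 0) (E (3 + m))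
  evenStep : ∀ {i} → i < 2 + m → PathEdge m (E (2 + i)) (E (1 + i))

-- The final `++ []` gives the even half the form `applyDownFrom f k ++ as`, so the lemmas about
-- descending runs cover both halves.
path : ℕ → List Vertex
path m = applyDownFrom O (3 + m) ++ O (3 + m) ∷ E 0 ∷ applyDownFrom (E ∘ suc) (3 + m) ++ []

-- The two edges at `E 0`, the last vertex in ω-order, have all later path vertices between their
-- ends. Every other edge has them outside: before both ends or after both.
path-chain : ∀ m → Chain (λ p q rs → PathEdge m p q × SidedList p q rs) (path m)
path-chain m =
  chain-downFrom O (2 + m)
    (λ i<2+m → oddStep i<2+m , inj₁ (All.++⁺
      (All.applyDownFrom⁺₁ O _ (λ j<i → inj₁ (O≺O (ℕ.m<n⇒m<1+n j<i) , O≺O j<i)))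
      (inj₂ (O≺O (s<s i<2+m) , O≺O (ℕ.m<n⇒m<1+n i<2+m)) ∷ inj₂ (O≺E , O≺E) ∷ evens (inj₂ (O≺E , O≺E)))))
  ((left , inj₁ (inj₂ (O≺E , O≺E) ∷ evens (inj₂ (O≺E , O≺E))))
  ∷ (diagonal , inj₂ (evens (inj₁ (O≺E , E≺E z<s))))
  ∷ (right , inj₂ (All.++⁺ (All.applyDownFrom⁺₁ (E ∘ suc) (2 + m)
      (λ i<2+m → inj₂ (E≺E (s<s i<2+m) , E≺E z<s))) []))
  ∷ chain-downFrom (E ∘ suc) (2 + m)
      (λ i<2+m → evenStep i<2+m , inj₁ (All.++⁺ (All.applyDownFrom⁺₁ (E ∘ suc) _
        (λ j<i → inj₂ (E≺E (s<s (ℕ.m<n⇒m<1+n j<i)) , E≺E (s<s j<i)))) []))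
      [-])
  where
  evens : ∀ {P : Vertex → Set} → (∀ {i} → P (E (suc i))) → All P (applyDownFrom (E ∘ suc) (3 + m) ++ [])
  evens Pe = All.++⁺ (All.applyDownFrom⁺₂ (E ∘ suc) (3 + m) (λ _ → Pe)) []

purpleEdge blueEdge : ℕ → Edge
purpleEdge i = purple , E i , O (2 + i)
blueEdge   i = blue   , O i , E (1 + i)

greenEdges : ℕ → List Edge
greenEdges m = (green , E 0 , E 1) ∷ (green , O (2 + m) , O (3 + m))
             ∷ (green , O 1 , E (3 + m)) ∷ (green , O 0 , E (2 + m)) ∷ []

edges : ℕ → Color → Color → List Edge
edges m x y =
  alternate x y (path m) ++ applyUpTo purpleEdge (2 + m) ++ applyUpTo blueEdge (3 + m) ++ greenEdges m

-- Keeps the starting color of the path open, while matching still rules out purple, blue and green.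
data PathColor : Color → Set where
  red   : PathColor red
  black : PathColor black

purple-compatible : ∀ m → AllPairs Compatible (applyUpTo purpleEdge (2 + m))
purple-compatible m = AllPairs.applyUpTo⁺₁ purpleEdge (2 + m) λ i<j _ → sameSide⇒compatible
  (inj₂ (inj₂ (O≺E , E≺E i<j) , inj₂ (O≺O (s<s (s<s i<j)) , O≺E)))

blue-compatible : ∀ m → AllPairs Compatible (applyUpTo blueEdge (3 + m))
blue-compatible m = AllPairs.applyUpTo⁺₁ blueEdge (3 + m) λ i<j _ → sameSide⇒compatible
  (inj₂ (inj₁ (O≺O i<j , O≺E) , inj₁ (O≺E , E≺E (s<s i<j))))

green-compatible : ∀ m → AllPairs Compatible (greenEdges m)
green-compatible m =
  (sameSide⇒compatible (inj₁ (inj₁ (O≺E , O≺E) , inj₁ (O≺E , O≺E)))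
    ∷ sameSide⇒compatible (inj₁ (inj₁ (O≺E , O≺E) , inj₁ (E≺E z<s , E≺E (s<s z<s))))
    ∷ sameSide⇒compatible (inj₁ (inj₁ (O≺E , O≺E) , inj₁ (E≺E z<s , E≺E (s<s z<s)))) ∷ [])
  ∷ (sameSide⇒compatible (inj₁ (inj₁ (O≺O (s<s z<s) , O≺O (s<s z<s)) , inj₂ (O≺E , O≺E)))
    ∷ sameSide⇒compatible (inj₁ (inj₁ (O≺O z<s , O≺O z<s) , inj₂ (O≺E , O≺E))) ∷ [])
  ∷ (sameSide⇒compatible (inj₁ (inj₁ (O≺O z<s , O≺E) , inj₂ (O≺E , E≺E (ℕ.n<1+n _)))) ∷ [])
  ∷ [] ∷ []

-- Edges of different colors must be distinct for the color to be unique. Only `diagonal` joins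
-- opposite parities, and it would be purple only if 3 + m = 2.
path-purple : ∀ {m p q i} → PathEdge m p q → ¬ Same p q (E i) (O (2 + i))
path-purple right        (inj₁ (_ , ()))
path-purple (evenStep _) (inj₁ (_ , ()))
path-purple diagonal     (inj₂ (refl , ()))

path-blue : ∀ {m p q i} → PathEdge m p q → ¬ Same p q (O i) (E (1 + i))
path-blue right        (inj₂ (() , _))
path-blue (evenStep _) (inj₂ (_ , ()))
path-blue diagonal     (inj₁ (refl , ()))

path-green : ∀ {m p q x} → PathColor x → PathEdge m p q → All (Compatible (x , p , q)) (greenEdges m)
path-green {m} {p} {q} {x} col e =
  different (e₁ e) ∷ different (e₂ e) ∷ different (e₃ e) ∷ different (e₄ e) ∷ []
  where
  different : ∀ {r s} → ¬ Same p q r s → Compatible (x , p , q) (green , r , s)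
  different d = d , λ { refl → contradiction col λ () }
  e₁ : ∀ {p q} → PathEdge m p q → ¬ Same p q (E 0) (E 1)
  e₁ right        (inj₁ (_ , ()))
  e₁ (evenStep _) (inj₁ (() , _))
  e₁ (evenStep _) (inj₂ (_ , ()))
  e₂ : ∀ {p q} → PathEdge m p q → ¬ Same p q (O (2 + m)) (O (3 + m))
  -- Here i = 2 + m, which the bound in `oddStep` excludes: the path reaches n - 1 from 1, not from
  -- n - 3.
  e₂ (oddStep i<i) (inj₂ (refl , refl)) = ℕ.<-irrefl refl i<i
  e₂ (oddStep _)   (inj₁ (refl , ()))
  e₂ left          (inj₁ (() , _))
  e₃ : ∀ {p q} → PathEdge m p q → ¬ Same p q (O 1) (E (3 + m))
  e₃ diagonal     (inj₁ (() , _))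
  e₃ right        (inj₂ (() , _))
  e₃ (evenStep _) (inj₂ (_ , ()))
  e₄ : ∀ {p q} → PathEdge m p q → ¬ Same p q (O 0) (E (2 + m))
  e₄ diagonal     (inj₁ (() , _))
  e₄ right        (inj₂ (() , _))
  e₄ (evenStep _) (inj₂ (_ , ()))

-- An edge in both families would force i = 1 + j and j = 2 + i.
purple-blue : ∀ i j → Compatible (purpleEdge i) (blueEdge j)
purple-blue i j = (λ { (inj₁ (() , _)) ; (inj₂ (refl , ())) }) , λ ()

purple-green : ∀ m i → All (Compatible (purpleEdge i)) (greenEdges m)
purple-green m i =
    ((λ { (inj₁ (_ , ())) ; (inj₂ (_ , ())) }) , λ ())
  ∷ ((λ { (inj₁ (() , _)) ; (inj₂ (() , _)) }) , λ ())
  ∷ ((λ { (inj₁ (() , _)) ; (inj₂ (_ , ())) }) , λ ())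
  ∷ ((λ { (inj₁ (() , _)) ; (inj₂ (_ , ())) }) , λ ()) ∷ []

blue-green : ∀ m i → All (Compatible (blueEdge i)) (greenEdges m)
blue-green m i =
    ((λ { (inj₁ (() , _)) ; (inj₂ (() , _)) }) , λ ())
  ∷ ((λ { (inj₁ (_ , ())) ; (inj₂ (_ , ())) }) , λ ())
  ∷ ((λ { (inj₁ (refl , ())) ; (inj₂ (() , _)) }) , λ ())
  ∷ ((λ { (inj₁ (refl , ())) ; (inj₂ (() , _)) }) , λ ()) ∷ []

chain-map : ∀ {A : Set} {R S : A → A → List A → Set} → (∀ {a b as} → R a b as → S a b as) →
            ∀ {as} → Chain R as → Chain S as
chain-map f []       = []
chain-map f [-]      = [-]
chain-map f (r ∷ rs) = f r ∷ chain-map f rs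

path-edges : ∀ {m x y} → PathColor x → PathColor y →
  All (λ { (z , p , q) → PathColor z × PathEdge m p q }) (alternate x y (path m))
path-edges {m} cx cy = All.zip (alternate-colors (path m) cx cy , alternate-edges proj₁ (path-chain m))

edges-compatible : ∀ m {x y} → PathColor x → PathColor y → x ≢ y → AllPairs Compatible (edges m x y)
edges-compatible m cx cy x≢y = AllPairs.++⁺ (chain⇒compatible x≢y (chain-map proj₂ (path-chain m)))
  (AllPairs.++⁺ (purple-compatible m)
    (AllPairs.++⁺ (blue-compatible m) (green-compatible m)
      (All.applyUpTo⁺₂ blueEdge (3 + m) (blue-green m)))
    (All.applyUpTo⁺₂ purpleEdge (2 + m) (λ i →
      All.++⁺ (All.applyUpTo⁺₂ blueEdge (3 + m) (purple-blue i)) (purple-green m i))))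
  (All.map (λ { (col , e) → All.++⁺
      (All.applyUpTo⁺₂ purpleEdge (2 + m) (λ i → path-purple e , λ { refl → contradiction col λ () }))
      (All.++⁺ (All.applyUpTo⁺₂ blueEdge (3 + m) (λ i → path-blue e , λ { refl → contradiction col λ () }))
        (path-green col e)) })
    (path-edges cx cy))

-- Adjacency as a step by 2 or 3, and completeness of the edge list

next : Vertex → Vertex
next (O i) = E i
next (E i) = O (suc i)

-- The vertices may leave the range of labels here; lap m p is p moved by n.
ahead : ℕ → Vertex → Vertex
ahead zero    p = p
ahead (suc k) p = next (ahead k p)

lap : ℕ → Vertex → Vertex
lap m (O i) = O (4 + m + i)
lap m (E i) = E (4 + m + i)

-- Labels and step lengths are at most n, so a step passes n at most once. The two equations are the
-- step without and with a wrap.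
Arc : ℕ → ℕ → Vertex → Vertex → Set
Arc m k p q = ahead k p ≡ q ⊎ ahead k p ≡ lap m q

Adjacent : ℕ → Vertex → Vertex → Set
Adjacent m p q = Any (λ k → Arc m k p q ⊎ Arc m k q p) (2 ∷ 3 ∷ [])

index : Vertex → ℕ
index (O i) = i
index (E i) = i

path⇒adjacent : ∀ {m p q} → PathEdge m p q → Adjacent m p q
path⇒adjacent (oddStep _)  = here (inj₂ (inj₁ refl))
path⇒adjacent {m} left     = here (inj₂ (inj₂ (cong (λ k → O (4 + k)) (sym (ℕ.+-identityʳ m)))))
path⇒adjacent {m} diagonal = there (here (inj₁ (inj₂ (cong (λ k → E (4 + k)) (sym (ℕ.+-identityʳ m))))))
path⇒adjacent {m} right    = here (inj₂ (inj₂ (cong (λ k → E (4 + k)) (sym (ℕ.+-identityʳ m)))))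
path⇒adjacent (evenStep _) = here (inj₂ (inj₁ refl))

edges-adjacent : ∀ m {x y} → PathColor x → PathColor y →
                 All (λ { (_ , p , q) → Adjacent m p q }) (edges m x y)
edges-adjacent m cx cy = All.++⁺ (All.map (path⇒adjacent ∘ proj₂) (path-edges cx cy))
  (All.++⁺ (All.applyUpTo⁺₂ purpleEdge (2 + m) (λ i → there (here (inj₁ (inj₁ refl)))))
  (All.++⁺ (All.applyUpTo⁺₂ blueEdge (3 + m) (λ i → there (here (inj₁ (inj₁ refl)))))
    (here (inj₁ (inj₁ refl))
      ∷ here (inj₁ (inj₁ refl))
      ∷ there (here (inj₂ (inj₂ (cong (λ k → O (4 + k)) (ℕ.+-comm 1 m)))))
      ∷ there (here (inj₂ (inj₂ (cong (λ k → O (4 + k)) (sym (ℕ.+-identityʳ m)))))) ∷ [])))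

module _ (m : ℕ) (x y : Color) where

  path∈edges : ∀ {p q} → Consecutive p q (path m) → ∃ λ z → (z , p , q) ∈ edges m x y
  path∈edges = map₂ ∈-++⁺ˡ ∘ consecutive⇒alternate x y

  odd∈path : ∀ {i} → i < 2 + m → Consecutive (O (suc i)) (O i) (path m)
  odd∈path = consecutive-downFrom O

  left∈path : Consecutive (O 0) (O (3 + m)) (path m)
  left∈path = consecutive-last O (2 + m)

  diagonal∈path : Consecutive (O (3 + m)) (E 0) (path m)
  diagonal∈path = consecutive-++ (applyDownFrom O (3 + m)) here

  right∈path : Consecutive (E 0) (E (3 + m)) (path m)
  right∈path = consecutive-++ (applyDownFrom O (3 + m)) (there here)

  even∈path : ∀ {i} → i < 2 + m → Consecutive (E (2 + i)) (E (1 + i)) (path m)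
  even∈path i< =
    consecutive-++ (applyDownFrom O (3 + m)) (there (there (consecutive-downFrom (E ∘ suc) i<)))

  purple∈edges : ∀ {i} → i < 2 + m → purpleEdge i ∈ edges m x y
  purple∈edges i< = ∈-++⁺ʳ (alternate x y (path m)) (∈-++⁺ˡ (∈-applyUpTo⁺ purpleEdge i<))

  blue∈edges : ∀ {i} → i < 3 + m → blueEdge i ∈ edges m x y
  blue∈edges i< = ∈-++⁺ʳ (alternate x y (path m))
    (∈-++⁺ʳ (applyUpTo purpleEdge (2 + m)) (∈-++⁺ˡ (∈-applyUpTo⁺ blueEdge i<)))

  green∈edges : ∀ {e} → e ∈ greenEdges m → e ∈ edges m x y
  green∈edges e∈ = ∈-++⁺ʳ (alternate x y (path m))
    (∈-++⁺ʳ (applyUpTo purpleEdge (2 + m)) (∈-++⁺ʳ (applyUpTo blueEdge (3 + m)) e∈))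

  Joined : Color → Vertex → Vertex → Set
  Joined z p q = (z , p , q) ∈ edges m x y ⊎ (z , q , p) ∈ edges m x y

  <suc⇒ : ∀ {i k} → i < suc k → i ≡ k ⊎ i < k
  <suc⇒ = Sum.swap ∘ ℕ.m≤n⇒m<n∨m≡n ∘ ℕ.s≤s⁻¹

  -- A step that wraps to index i starts at an index c + (m + i) with a constant c. The bound 4 + m
  -- on the start then leaves only i < 4 - c.
  excess : ∀ {i b} → m + i < b + m → i < b
  excess {i} {b} lt = ℕ.+-cancelˡ-< m i b (subst (m + i <_) (ℕ.+-comm b m) lt)

  -- Without a wrap, a step by 2 is a path edge, except for 2-4 and (n-3)-(n-1), which the path
  -- skips and green supplies. The steps that wrap, n-1 to 1 and n to 2, are `left` and `right`.
  step2-joined : ∀ {p q} → index p < 4 + m → index q < 4 + m → Arc m 2 p q → ∃ λ z → Joined z p q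
  step2-joined {O i} p< q< (inj₁ refl) with <suc⇒ (ℕ.s<s⁻¹ q<)
  ... | inj₁ refl = green , inj₁ (green∈edges (there (here refl)))
  ... | inj₂ i<   = map₂ inj₂ (path∈edges (odd∈path i<))
  step2-joined {E zero} p< q< (inj₁ refl) = green , inj₁ (green∈edges (here refl))
  step2-joined {E (suc i)} p< q< (inj₁ refl) = map₂ inj₂ (path∈edges (even∈path (ℕ.s<s⁻¹ (ℕ.s<s⁻¹ q<))))
  step2-joined {O _} {O zero} p< q< (inj₂ refl) rewrite ℕ.+-identityʳ m = map₂ inj₂ (path∈edges left∈path)
  step2-joined {E _} {E zero} p< q< (inj₂ refl) rewrite ℕ.+-identityʳ m = map₂ inj₂ (path∈edges right∈path)
  step2-joined {O _} {O (suc j)} p< q< (inj₂ refl) with excess {suc j} {1} (ℕ.s<s⁻¹ (ℕ.s<s⁻¹ (ℕ.s<s⁻¹ p<)))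
  ... | s<s ()
  step2-joined {E _} {E (suc j)} p< q< (inj₂ refl) with excess {suc j} {1} (ℕ.s<s⁻¹ (ℕ.s<s⁻¹ (ℕ.s<s⁻¹ p<)))
  ... | s<s ()

  -- Without a wrap, the parity of the smaller label decides between blue and purple. Three steps
  -- wrap: n-1 to 2 is the diagonal of the path, while n-2 to 1 and n to 3 are green.
  step3-joined : ∀ {p q} → index p < 4 + m → index q < 4 + m → Arc m 3 p q → ∃ λ z → Joined z p q
  step3-joined {O i} p< q< (inj₁ refl) = blue , inj₁ (blue∈edges (ℕ.s<s⁻¹ q<))
  step3-joined {E i} p< q< (inj₁ refl) = purple , inj₁ (purple∈edges (ℕ.s<s⁻¹ (ℕ.s<s⁻¹ q<)))
  step3-joined {O _} {E zero} p< q< (inj₂ refl) rewrite ℕ.+-identityʳ m = map₂ inj₁ (path∈edges diagonal∈path)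
  step3-joined {O _} {E (suc j)} p< q< (inj₂ refl) with excess {suc j} {1} (ℕ.s<s⁻¹ (ℕ.s<s⁻¹ (ℕ.s<s⁻¹ p<)))
  ... | s<s ()
  step3-joined {E _} {O zero} p< q< (inj₂ refl) rewrite ℕ.+-identityʳ m =
    green , inj₂ (green∈edges (there (there (there (here refl)))))
  step3-joined {E _} {O (suc zero)} p< q< (inj₂ refl) rewrite ℕ.+-comm m 1 =
    green , inj₂ (green∈edges (there (there (here refl))))
  step3-joined {E _} {O (suc (suc j))} p< q< (inj₂ refl) with excess {suc (suc j)} {2} (ℕ.s<s⁻¹ (ℕ.s<s⁻¹ p<))
  ... | s<s (s<s ())

  adjacent⇒joined : ∀ {p q} → index p < 4 + m → index q < 4 + m → Adjacent m p q → ∃ λ z → Joined z p q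
  adjacent⇒joined p< q< (here (inj₁ a))         = step2-joined p< q< a
  adjacent⇒joined p< q< (here (inj₂ a))         = map₂ Sum.swap (step2-joined q< p< a)
  adjacent⇒joined p< q< (there (here (inj₁ a))) = step3-joined p< q< a
  adjacent⇒joined p< q< (there (here (inj₂ a))) = map₂ Sum.swap (step3-joined q< p< a)

-- Comparison of two colored edges

pairwise : ∀ {A : Set} {R : A → A → Set} {xs a b} → AllPairs R xs → a ∈ xs → b ∈ xs → a ≡ b ⊎ R a b ⊎ R b a
pairwise (_ ∷ _)  (here refl) (here refl) = inj₁ refl
pairwise (r ∷ _)  (here refl) (there b∈)  = inj₂ (inj₁ (All.lookup r b∈))
pairwise (r ∷ _)  (there a∈)  (here refl) = inj₂ (inj₂ (All.lookup r a∈))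
pairwise (_ ∷ rs) (there a∈)  (there b∈)  = pairwise rs a∈ b∈

same-swapˡ : ∀ {A : Set} {p q r s : A} → Same p q r s → Same q p r s
same-swapˡ (inj₁ (p≡r , q≡s)) = inj₂ (q≡s , p≡r)
same-swapˡ (inj₂ (p≡s , q≡r)) = inj₁ (q≡r , p≡s)

compatible-swapˡ : ∀ {x y p q r s} → Compatible (x , p , q) (y , r , s) → Compatible (x , q , p) (y , r , s)
compatible-swapˡ (d , ss) = d ∘ same-swapˡ , Sum.map
  (λ (r , s) → Sum.map Product.swap Product.swap r , Sum.map Product.swap Product.swap s)
  (λ (r , s) → Sum.swap r , Sum.swap s) ∘ ss

compatible-swapʳ : ∀ {x y p q r s} → Compatible (x , p , q) (y , r , s) → Compatible (x , p , q) (y , s , r)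
compatible-swapʳ (d , ss) = d ∘ Sum.swap , Sum.map Product.swap Product.swap ∘ ss

-- `Compatible` uses the line through its first edge. The order in the list decides which edge that
-- is, and either one suffices to keep the edges apart.
Comparison : (x : Color) (p q : Vertex) (y : Color) (r s : Vertex) → Set
Comparison x p q y r s =
  (Same p q r s × x ≡ y) ⊎ Compatible (x , p , q) (y , r , s) ⊎ Compatible (y , r , s) (x , p , q)

compare : ∀ m {x y} → PathColor x → PathColor y → x ≢ y → ∀ {z w p q r s} →
          Joined m x y z p q → Joined m x y w r s → Comparison z p q w r s
compare m {x} {y} cx cy x≢y = joined
  where
  listed : ∀ {z w p q r s} → (z , p , q) ∈ edges m x y → (w , r , s) ∈ edges m x y → Comparison z p q w r s
  listed e f with pairwise (edges-compatible m cx cy x≢y) e f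
  ... | inj₁ refl = inj₁ (inj₁ (refl , refl) , refl)
  ... | inj₂ comp = inj₂ comp

  swapʳ : ∀ {z w p q r s} → Comparison z p q w r s → Comparison z p q w s r
  swapʳ = Sum.map (λ (s , eq) → Sum.swap s , eq) (Sum.map compatible-swapʳ compatible-swapˡ)

  swapˡ : ∀ {z w p q r s} → Comparison z p q w r s → Comparison z q p w r s
  swapˡ = Sum.map (λ (s , eq) → same-swapˡ s , eq) (Sum.map compatible-swapˡ compatible-swapʳ)

  joined : ∀ {z w p q r s} → Joined m x y z p q → Joined m x y w r s → Comparison z p q w r s
  joined (inj₁ e) (inj₁ f) = listed e f
  joined (inj₁ e) (inj₂ f) = swapʳ (listed e f)
  joined (inj₂ e) (inj₁ f) = swapˡ (listed e f)
  joined (inj₂ e) (inj₂ f) = swapˡ (swapʳ (listed e f))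

-- Labels

num-next : ∀ p → num (next p) ≡ suc (num p)
num-next (O i) = refl
num-next (E i) = refl

num-ahead : ∀ k p → num (ahead k p) ≡ k + num p
num-ahead zero    p = refl
num-ahead (suc k) p = trans (num-next (ahead k p)) (cong suc (num-ahead k p))

num-lap : ∀ m p → num (lap m p) ≡ num p + (8 + m * 2)
num-lap m (O i) = trans (cong suc (ℕ.*-distribʳ-+ 2 (4 + m) i)) (cong suc (ℕ.+-comm (8 + m * 2) (i * 2)))
num-lap m (E i) = trans (cong (2 +_) (ℕ.*-distribʳ-+ 2 (4 + m) i)) (cong (2 +_) (ℕ.+-comm (8 + m * 2) (i * 2)))

vertex : ℕ → Vertex
vertex k = ahead k (O 0)

num-vertex : ∀ k → num (vertex k) ≡ suc k
num-vertex k = trans (num-ahead k (O 0)) (ℕ.+-comm k 1)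

vertex-num : ∀ p → vertex (ℕ.pred (num p)) ≡ p
vertex-num (O zero)    = refl
vertex-num (O (suc i)) = cong (next ∘ next) (vertex-num (O i))
vertex-num (E zero)    = refl
vertex-num (E (suc i)) = cong (next ∘ next) (vertex-num (E i))

num-injective : ∀ {p q} → num p ≡ num q → p ≡ q
num-injective {p} {q} eq = trans (sym (vertex-num p)) (trans (cong (vertex ∘ ℕ.pred) eq) (vertex-num q))

applyDownFrom-cong : ∀ {A : Set} {f g : ℕ → A} → (∀ i → f i ≡ g i) →
                     ∀ k → applyDownFrom f k ≡ applyDownFrom g k
applyDownFrom-cong f≗g zero    = refl
applyDownFrom-cong f≗g (suc k) = cong₂ _∷_ (f≗g k) (applyDownFrom-cong f≗g k)

applyUpTo-cong : ∀ {A : Set} {f g : ℕ → A} → (∀ i → f i ≡ g i) →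
                 ∀ k → applyUpTo f k ≡ applyUpTo g k
applyUpTo-cong f≗g zero    = refl
applyUpTo-cong f≗g (suc k) = cong₂ _∷_ (f≗g 0) (applyUpTo-cong (f≗g ∘ suc) k)

⌊m*2/2⌋≡m : ∀ m → ⌊ m * 2 /2⌋ ≡ m
⌊m*2/2⌋≡m zero    = refl
⌊m*2/2⌋≡m (suc m) = cong suc (⌊m*2/2⌋≡m m)

numEdge : Edge → Color × ℕ × ℕ
numEdge (x , p , q) = x , num p , num q

alternating-map : ∀ x y ps → alternating x y (map num ps) ≡ map numEdge (alternate x y ps)
alternating-map x y []           = refl
alternating-map x y (_ ∷ [])     = refl
alternating-map x y (p ∷ q ∷ ps) = cong (_ ∷_) (alternating-map y x (q ∷ ps))

hamiltonianPath-num : ∀ m → hamiltonianPath (8 + m * 2) ≡ map num (path m)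
hamiltonianPath-num m rewrite ⌊m*2/2⌋≡m m = begin
  applyDownFrom (λ i → 1 + 2 * i) k ++ 7 + m * 2 ∷ 2 ∷ applyDownFrom (λ i → 4 + 2 * i) k
    ≡⟨ cong₂ (λ as bs → as ++ 7 + m * 2 ∷ 2 ∷ bs)
         (trans (applyDownFrom-cong (λ i → cong (1 +_) (ℕ.*-comm 2 i)) k) (sym (map-applyDownFrom O num k)))
         (trans (applyDownFrom-cong (λ i → cong (4 +_) (ℕ.*-comm 2 i)) k)
           (trans (sym (map-applyDownFrom (E ∘ suc) num k))
             (cong (map num) (sym (++-identityʳ (applyDownFrom (E ∘ suc) k)))))) ⟩
  map num (applyDownFrom O k) ++ map num (O k ∷ E 0 ∷ applyDownFrom (E ∘ suc) k ++ [])
    ≡⟨ map-++ num (applyDownFrom O k) _ ⟨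
  map num (path m) ∎
  where
  open ≡-Reasoning
  k = 3 + m

first second : Bool → Color
first  redFirst = if redFirst then red else black
second redFirst = if redFirst then black else red

first-pathColor : ∀ rf → PathColor (first rf)
first-pathColor true  = red
first-pathColor false = black

second-pathColor : ∀ rf → PathColor (second rf)
second-pathColor true  = black
second-pathColor false = red

first≢second : ∀ rf → first rf ≢ second rf
first≢second true  ()
first≢second false ()

coloredEdges-num : ∀ m rf → coloredEdges (8 + m * 2) rf ≡ map numEdge (edges m (first rf) (second rf))
coloredEdges-num m rf = begin
  coloredEdges (8 + m * 2) rf
    ≡⟨ cong₂ _++_ (paths rf) (cong₂ _++_ purples (cong (_++ map numEdge (greenEdges m)) blues)) ⟩
  map numEdge ps ++ map numEdge us ++ map numEdge bs ++ map numEdge (greenEdges m)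
    ≡⟨ cong (λ es → map numEdge ps ++ map numEdge us ++ es) (map-++ numEdge bs (greenEdges m)) ⟨
  map numEdge ps ++ map numEdge us ++ map numEdge (bs ++ greenEdges m)
    ≡⟨ cong (map numEdge ps ++_) (map-++ numEdge us _) ⟨
  map numEdge ps ++ map numEdge (us ++ bs ++ greenEdges m)
    ≡⟨ map-++ numEdge ps _ ⟨
  map numEdge (edges m (first rf) (second rf)) ∎
  where
  open ≡-Reasoning
  ps = alternate (first rf) (second rf) (path m)
  us = applyUpTo purpleEdge (2 + m)
  bs = applyUpTo blueEdge (3 + m)
  alt : ∀ x y → alternating x y (hamiltonianPath (8 + m * 2)) ≡ map numEdge (alternate x y (path m))
  alt x y = trans (cong (alternating x y) (hamiltonianPath-num m)) (alternating-map x y (path m))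
  paths : ∀ rf → (if rf then alternating red black (hamiltonianPath (8 + m * 2))
                        else alternating black red (hamiltonianPath (8 + m * 2)))
                 ≡ map numEdge (alternate (first rf) (second rf) (path m))
  paths true  = alt red black
  paths false = alt black red
  step3 : ∀ k i → k + 2 * i + 3 ≡ 3 + k + i * 2
  step3 k i = trans (ℕ.+-comm (k + 2 * i) 3) (cong (λ j → 3 + (k + j)) (ℕ.*-comm 2 i))
  purples : applyUpTo (λ i → purple , 2 + 2 * i , 2 + 2 * i + 3) (⌊ 8 + m * 2 /2⌋ ∸ 2) ≡ map numEdge us
  purples rewrite ⌊m*2/2⌋≡m m =
    trans (applyUpTo-cong (λ i → cong₂ (λ a b → purple , a , b) (cong (2 +_) (ℕ.*-comm 2 i)) (step3 2 i)) (2 + m))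
      (sym (map-applyUpTo purpleEdge numEdge (2 + m)))
  blues : applyUpTo (λ i → blue , 1 + 2 * i , 1 + 2 * i + 3) (⌊ 8 + m * 2 /2⌋ ∸ 1) ≡ map numEdge bs
  blues rewrite ⌊m*2/2⌋≡m m =
    trans (applyUpTo-cong (λ i → cong₂ (λ a b → blue , a , b) (cong (1 +_) (ℕ.*-comm 2 i)) (step3 1 i)) (3 + m))
      (sym (map-applyUpTo blueEdge numEdge (3 + m)))

-- The vertices of the graph in parity form

V : ∀ {n} → Fin n → Vertex
V u = vertex (toℕ u)

num-V : ∀ {n} (u : Fin n) → num (V u) ≡ label u
num-V u = num-vertex (toℕ u)

V-injective : ∀ {n} {u v : Fin n} → V u ≡ V v → u ≡ v
V-injective {u = u} {v} eq =
  Fin.toℕ-injective (ℕ.suc-injective (trans (sym (num-V u)) (trans (cong num eq) (num-V v))))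

index< : ∀ k p → num p ≤ k * 2 → index p < k
index< k (O i) le = ℕ.*-cancelʳ-< 2 i k le
index< k (E i) le = ℕ.*-cancelʳ-< 2 i k (ℕ.<⇒≤ le)

V-index< : ∀ k (u : Fin (k * 2)) → index (V u) < k
V-index< k u = index< k (V u) (subst (_≤ k * 2) (sym (num-V u)) (Fin.toℕ<n u))

module _ (m : ℕ) (rf : Bool) where
  private
    n  = 8 + m * 2
    es = edges m (first rf) (second rf)

  joined⇒c : ∀ {x} {u v : Fin n} → Joined m (first rf) (second rf) x (V u) (V v) → c n rf x u v
  joined⇒c {x} {u} {v} = Sum.map (listed u v) (listed v u)
    where
    listed : ∀ u v → (x , V u , V v) ∈ es → (x , label u , label v) ∈ coloredEdges n rf
    listed u v e = subst₂ _∈_ (cong₂ (λ a b → x , a , b) (num-V u) (num-V v))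
                              (sym (coloredEdges-num m rf)) (∈-map⁺ numEdge e)

  c⇒joined : ∀ {x} {u v : Fin n} → c n rf x u v → Joined m (first rf) (second rf) x (V u) (V v)
  c⇒joined {x} {u} {v} = Sum.map (listed u v) (listed v u)
    where
    listed : ∀ (u v : Fin n) → (x , label u , label v) ∈ coloredEdges n rf → (x , V u , V v) ∈ es
    listed u v e with ∈-map⁻ numEdge (subst ((x , label u , label v) ∈_) (coloredEdges-num m rf) e)
    ... | (_ , p , q) , e′ , eq = subst (_∈ es)
      (cong₂ _,_ (sym (cong proj₁ eq))
        (cong₂ _,_ (num-injective (trans (sym (cong (proj₁ ∘ proj₂) eq)) (sym (num-V u))))
                   (num-injective (trans (sym (cong (proj₂ ∘ proj₂) eq)) (sym (num-V v))))))
      e′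

-- If a + i ≥ b, the upper bound leaves the quotients 0 and 1. If a + i ≤ b, the difference is below
-- b ≤ n because a ≥ 1, so divisibility makes it zero.
cong-mod⇒ : ∀ {n i a b} → 1 ≤ a → b ≤ n → a + i < b + 2 * n →
            (a + i) ≡ b [mod n ] → a + i ≡ b ⊎ a + i ≡ b + n
cong-mod⇒ {n} {i} {a} {b} 1≤a b≤n a+i< n∣ with ℕ.≤-total b (a + i)
... | inj₁ b≤ = quotient (subst (n ∣_) (ℕ.m≤n⇒∣n-m∣≡n∸m b≤) n∣)
  where
  quotient : n ∣ a + i ∸ b → a + i ≡ b ⊎ a + i ≡ b + n
  quotient (divides k eq) with trans (sym (ℕ.m+[n∸m]≡n b≤)) (cong (b +_) eq)
  ... | a+i≡ with k
  ... | 0 = inj₁ (trans a+i≡ (ℕ.+-identityʳ b))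
  ... | 1 = inj₂ (trans a+i≡ (cong (b +_) (ℕ.+-identityʳ n)))
  ... | suc (suc k) = contradiction a+i< (ℕ.≤⇒≯ (subst (b + 2 * n ≤_) (sym a+i≡)
                        (ℕ.+-monoʳ-≤ b (ℕ.*-monoˡ-≤ n (s≤s (s≤s (z≤n {k})))))))
... | inj₂ ≤b with b ∸ (a + i) in eq | subst (n ∣_) (ℕ.m≤n⇒∣m-n∣≡n∸m ≤b) n∣
... | zero  | _   = inj₁ (ℕ.≤-antisym ≤b (ℕ.m∸n≡0⇒m≤n eq))
... | suc d | n∣d = contradiction n∣d (>⇒∤ (ℕ.<-≤-trans d<b b≤n))
  where
  d<b : suc d < b
  d<b = subst (suc d <_) (trans (cong (a + i +_) (sym eq)) (ℕ.m+[n∸m]≡n ≤b))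
              (ℕ.m<n+m (suc d) (ℕ.≤-trans 1≤a (ℕ.m≤m+n a i)))

cong-mod⇐ : ∀ {n i a b} → a + i ≡ b ⊎ a + i ≡ b + n → (a + i) ≡ b [mod n ]
cong-mod⇐ {n} {b = b} (inj₁ eq) = subst (n ∣_) (sym (ℕ.m≡n⇒∣m-n∣≡0 eq)) (n ∣0)
cong-mod⇐ {n} {b = b} (inj₂ eq) = subst (n ∣_)
  (sym (trans (cong (∣_- b ∣) eq) (trans (ℕ.∣-∣-comm (b + n) b) (ℕ.∣m-m+n∣≡n b n)))) ∣-refl

module _ (m : ℕ) (S : List ℕ) where
  private n = 8 + m * 2

  label-ahead : ∀ k (u : Fin n) → num (ahead k (V u)) ≡ label u + k
  label-ahead k u = trans (num-ahead k (V u)) (trans (cong (k +_) (num-V u)) (ℕ.+-comm k (label u)))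

  label-lap : ∀ (v : Fin n) → num (lap m (V v)) ≡ label v + n
  label-lap v = trans (num-lap m (V v)) (cong (_+ n) (num-V v))

  step⇒ : ∀ {k} u v → k ≤ n → Step n S u v k → label u + k ≡ label v ⊎ label u + k ≡ label v + n
  step⇒ {k} u v k≤n = cong-mod⇒ {a = label u} {label v} z<s (Fin.toℕ<n v) (s<s (begin-strict
    toℕ u + k           <⟨ ℕ.+-mono-<-≤ (Fin.toℕ<n u) k≤n ⟩
    n + n               ≡⟨ cong (n +_) (ℕ.+-identityʳ n) ⟨
    2 * n               ≤⟨ ℕ.m≤n+m (2 * n) (toℕ v) ⟩
    toℕ v + 2 * n       ∎))
    where open ℕ.≤-Reasoning

  step⇒arc : ∀ {k} u v → k ≤ n → Step n S u v k → Arc m k (V u) (V v)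
  step⇒arc {k} u v k≤n s = Sum.map
    (λ eq → num-injective (trans (label-ahead k u) (trans eq (sym (num-V v)))))
    (λ eq → num-injective (trans (label-ahead k u) (trans eq (sym (label-lap v)))))
    (step⇒ u v k≤n s)

  arc⇒step : ∀ {k} u v → Arc m k (V u) (V v) → Step n S u v k
  arc⇒step {k} u v a = cong-mod⇐ {a = label u} {label v} (Sum.map
    (λ eq → trans (sym (label-ahead k u)) (trans (cong num eq) (num-V v)))
    (λ eq → trans (sym (label-ahead k u)) (trans (cong num eq) (label-lap v))) a)

  label≢+n : ∀ (v w : Fin n) → label v ≢ label w + n
  label≢+n v w = ℕ.<⇒≢ (ℕ.<-≤-trans (s<s (Fin.toℕ<n v)) (s≤s (ℕ.m≤n+m n (toℕ w))))

  label-injective : ∀ {v w : Fin n} → label v ≡ label w → v ≡ w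
  label-injective = Fin.toℕ-injective ∘ ℕ.suc-injective

  -- Labels from 1 to n never differ by n, so one target without a wrap and another with a wrap
  -- cannot both occur.
  step-functional : ∀ {k} u v w → k ≤ n → Step n S u v k → Step n S u w k → v ≡ w
  step-functional u v w k≤n s t with step⇒ u v k≤n s | step⇒ u w k≤n t
  ... | inj₁ eq | inj₁ eq′ = label-injective (trans (sym eq) eq′)
  ... | inj₁ eq | inj₂ eq′ = contradiction (trans (sym eq) eq′) (label≢+n v w)
  ... | inj₂ eq | inj₁ eq′ = contradiction (trans (sym eq′) eq) (label≢+n w v)
  ... | inj₂ eq | inj₂ eq′ = label-injective (ℕ.+-cancelʳ-≡ n _ _ (trans (sym eq) eq′))

  behind : ∀ {a b c k} → a + k ≡ c → b + k ≡ c + n → b ≡ a + n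
  behind {a} {b} {c} {k} eq eq′ = ℕ.+-cancelʳ-≡ k b (a + n) (begin
    b + k        ≡⟨ eq′ ⟩
    c + n        ≡⟨ cong (_+ n) eq ⟨
    a + k + n    ≡⟨ ℕ.+-assoc a k n ⟩
    a + (k + n)  ≡⟨ cong (a +_) (ℕ.+-comm k n) ⟩
    a + (n + k)  ≡⟨ ℕ.+-assoc a n k ⟨
    a + n + k    ∎)
    where open ≡-Reasoning

  step-injective : ∀ {k} u v w → k ≤ n → Step n S v u k → Step n S w u k → v ≡ w
  step-injective {k} u v w k≤n s t with step⇒ v u k≤n s | step⇒ w u k≤n t
  ... | inj₁ eq | inj₁ eq′ = label-injective (ℕ.+-cancelʳ-≡ k _ _ (trans eq (sym eq′)))
  ... | inj₁ eq | inj₂ eq′ = contradiction (behind eq eq′) (label≢+n w v)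
  ... | inj₂ eq | inj₁ eq′ = contradiction (behind eq′ eq) (label≢+n v w)
  ... | inj₂ eq | inj₂ eq′ = label-injective (ℕ.+-cancelʳ-≡ k _ _ (trans eq (sym eq′)))

-- The cyclic order

filter-¬++filter : ∀ {A : Set} {P : A → Set} (P? : Decidable P) xs →
  filter (¬? ∘ P?) xs ++ filter P? xs ↭ xs
filter-¬++filter P? [] = ↭-refl
filter-¬++filter P? (x ∷ xs) with P? x
... | yes _ = ↭-trans (shift x (filter (¬? ∘ P?) xs) (filter P? xs)) (prep x (filter-¬++filter P? xs))
... | no  _ = prep x (filter-¬++filter P? xs)

ω-↭ : ∀ n → ω n ↭ allFin n
ω-↭ n = ↭-trans (++⁺ˡ (filter (λ v → ¬? (2 ∣? label v)) (allFin n)) (↭-reverse _))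
  (filter-¬++filter (λ v → 2 ∣? label v) (allFin n))

reverse⁺ : ∀ {A : Set} {R : A → A → Set} {xs} → AllPairs R xs → AllPairs (flip R) (reverse xs)
reverse⁺ [] = []
reverse⁺ {R = R} {xs = x ∷ xs} (r ∷ rs) = subst (AllPairs (flip R)) (sym (unfold-reverse x xs))
  (AllPairs.++⁺ (reverse⁺ rs) ([] ∷ []) (All.map (_∷ []) (All-resp-↭ (↭-sym (↭-reverse xs)) r)))

restrict : ∀ {A : Set} {P : A → Set} {R : A → A → Set} {xs} → All P xs → AllPairs R xs →
           AllPairs (λ x y → P x × P y × R x y) xs
restrict []       []       = []
restrict (p ∷ ps) (r ∷ rs) = All.zipWith (λ (q , s) → p , q , s) (ps , r) ∷ restrict ps rs

2∣E : ∀ i → 2 ∣ num (E i)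
2∣E i = divides (suc i) refl

2∤O : ∀ i → ¬ 2 ∣ num (O i)
2∤O i 2∣ = contradiction (∣1⇒≡1 (∣m+n∣m⇒∣n (subst (2 ∣_) (ℕ.+-comm 1 (i * 2)) 2∣) (n∣m*n i))) λ ()

odds-≺ : ∀ p q → ¬ 2 ∣ num p → ¬ 2 ∣ num q → num p < num q → p ≺ q
odds-≺ (E i) _     ¬e _  _  = contradiction (2∣E i) ¬e
odds-≺ (O i) (E j) _  ¬e _  = contradiction (2∣E j) ¬e
odds-≺ (O i) (O j) _  _  lt = O≺O (ℕ.*-cancelʳ-< 2 i j (ℕ.s<s⁻¹ lt))

evens-≺ : ∀ p q → 2 ∣ num p → 2 ∣ num q → num q < num p → p ≺ q
evens-≺ (O i) _     e _ _  = contradiction e (2∤O i)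
evens-≺ (E i) (O j) _ e _  = contradiction e (2∤O j)
evens-≺ (E i) (E j) _ _ lt = E≺E (ℕ.*-cancelʳ-< 2 j i (ℕ.s<s⁻¹ (ℕ.s<s⁻¹ lt)))

odd-even-≺ : ∀ p q → ¬ 2 ∣ num p → 2 ∣ num q → p ≺ q
odd-even-≺ (E i) _     ¬e _ = contradiction (2∣E i) ¬e
odd-even-≺ (O i) (O j) _  e = contradiction e (2∤O j)
odd-even-≺ (O i) (E j) _  _ = O≺E

_⊏_ : ∀ {n} → Fin n → Fin n → Set
u ⊏ v = V u ≺ V v

-- Together with `position-mono` this avoids computing positions: only their order enters
-- `SameSide`.
ω-sorted : ∀ n → AllPairs _⊏_ (ω n)
ω-sorted n = AllPairs.++⁺
  (AllPairs.map (λ {u} {v} (o , o′ , u<v) → odds-≺ (V u) (V v) (to o) (to o′) (<V u v u<v))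
    (restrict odds (AllPairs.filter⁺ odd? increasing)))
  (AllPairs.map (λ {u} {v} (e , e′ , v<u) → evens-≺ (V u) (V v) (from e) (from e′) (<V v u v<u))
    (restrict evens (reverse⁺ (AllPairs.filter⁺ even? increasing))))
  (All.map (λ {u} o → All.map (λ {v} e → odd-even-≺ (V u) (V v) (to o) (from e)) evens) odds)
  where
  even? = λ (v : Fin n) → 2 ∣? label v
  odd?  = λ (v : Fin n) → ¬? (2 ∣? label v)
  increasing : AllPairs Fin._<_ (allFin n)
  increasing = AllPairs.tabulate⁺-< id
  odds : All (λ v → ¬ 2 ∣ label v) (filter odd? (allFin n))
  odds = All.all-filter odd? (allFin n)
  evens : All (λ v → 2 ∣ label v) (reverse (filter even? (allFin n)))
  evens = All-resp-↭ (↭-sym (↭-reverse _)) (All.all-filter even? (allFin n))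
  from : ∀ {v : Fin n} → 2 ∣ label v → 2 ∣ num (V v)
  from {v} = subst (2 ∣_) (sym (num-V v))
  to : ∀ {v : Fin n} → ¬ 2 ∣ label v → ¬ 2 ∣ num (V v)
  to {v} o = o ∘ subst (2 ∣_) (num-V v)
  <V : ∀ (u v : Fin n) → u Fin.< v → num (V u) < num (V v)
  <V u v u<v = subst₂ _<_ (sym (num-V u)) (sym (num-V v)) (s<s u<v)

≺-asym : ∀ {p q} → p ≺ q → ¬ q ≺ p
≺-asym (O≺O i<j) (O≺O j<i) = ℕ.<-asym i<j j<i
≺-asym (E≺E i<j) (E≺E j<i) = ℕ.<-asym i<j j<i

position-mono : ∀ {n} {us : List (Fin n)} {u v} → AllPairs _⊏_ us → u ∈ us → v ∈ us → u ⊏ v →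
                position us u < position us v
position-mono {us = w ∷ us} {u} {v} (w⊏ ∷ sorted) u∈ v∈ u⊏v with w ≟ u | w ≟ v
... | yes refl | yes refl = contradiction u⊏v ≺-irrefl
... | yes refl | no _     = z<s
... | no w≢u   | yes refl = contradiction u⊏v (≺-asym (All.lookup w⊏ (Any.tail (w≢u ∘ sym) u∈)))
... | no w≢u   | no w≢v   = s<s (position-mono sorted (Any.tail (w≢u ∘ sym) u∈) (Any.tail (w≢v ∘ sym) v∈) u⊏v)

∈-ω : ∀ {n} (v : Fin n) → v ∈ ω n
∈-ω {n} v = ∈-resp-↭ (↭-sym (ω-↭ n)) (∈-allFin v)

ω-mono : ∀ {n} {u v : Fin n} → u ⊏ v → position (ω n) u < position (ω n) v
ω-mono {n} {u} {v} = position-mono (ω-sorted n) (∈-ω u) (∈-ω v)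

sameSide-map : ∀ {A B : Set} (_<₁_ : A → A → Set) (_<₂_ : B → B → Set) (f : A → B) →
  (∀ a b → a <₁ b → f a <₂ f b) → ∀ p q r s →
  SameSide _<₁_ p q r s → SameSide _<₂_ (f p) (f q) (f r) (f s)
sameSide-map _<₁_ _<₂_ f mono p q r s =
  Sum.map (Product.map (outside r) (outside s)) (Product.map (inside r) (inside s))
  where
  outside : ∀ r → Outside _<₁_ p q r → Outside _<₂_ (f p) (f q) (f r)
  outside r = Sum.map (Product.map (mono r p) (mono r q)) (Product.map (mono p r) (mono q r))
  inside : ∀ r → Inside _<₁_ p q r → Inside _<₂_ (f p) (f q) (f r)
  inside r = Sum.map (Product.map (mono p r) (mono r q)) (Product.map (mono q r) (mono r p))

noCross : ∀ {n} {u v u′ v′ : Fin n} → SameSide _⊏_ u v u′ v′ → ¬ Cross (ω n) u v u′ v′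
noCross {n} {u} {v} {u′} {v′} ss (X , on , on′ , _) =
  chords-disjoint (at u) (at v) (at u′) (at v′)
    (sameSide-map _⊏_ _<_ at (λ a b → ω-mono {n} {a} {b}) u v u′ v′ ss) on on′
  where at = position (ω n)

cross-sym : ∀ {n} {us : List (Fin n)} {u v u′ v′} → Cross us u v u′ v′ → Cross us u′ v′ u v
cross-sym (X , on , on′ , a , b , a′ , b′) = X , on′ , on , a′ , b′ , a , b

disjoint : ∀ {n} {u v u′ v′ : Fin n} → SameSide _≺_ (V u) (V v) (V u′) (V v′) → ¬ ShareEndpoint u v u′ v′
disjoint ss with sameSide⇒≢ ss
... | (p≢r , q≢r) , (p≢s , q≢s) = λ where
  (inj₁ (inj₁ refl)) → p≢r refl
  (inj₁ (inj₂ refl)) → p≢s refl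
  (inj₂ (inj₁ refl)) → q≢r refl
  (inj₂ (inj₂ refl)) → q≢s refl

shareEndpoint-sym : ∀ {n} {u v u′ v′ : Fin n} → ShareEndpoint u v u′ v′ → ShareEndpoint u′ v′ u v
shareEndpoint-sym (inj₁ (inj₁ eq)) = inj₁ (inj₁ (sym eq))
shareEndpoint-sym (inj₁ (inj₂ eq)) = inj₂ (inj₁ (sym eq))
shareEndpoint-sym (inj₂ (inj₁ eq)) = inj₁ (inj₂ (sym eq))
shareEndpoint-sym (inj₂ (inj₂ eq)) = inj₂ (inj₂ (sym eq))

same⇒sameEdge : ∀ {n} {u v u′ v′ : Fin n} → Same (V u) (V v) (V u′) (V v′) → SameEdge u v u′ v′
same⇒sameEdge = Sum.map (Product.map V-injective V-injective) (Product.map V-injective V-injective)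

separated : ∀ {n x} (u v u′ v′ : Fin n) → ¬ SameEdge u v u′ v′ → Comparison x (V u) (V v) x (V u′) (V v′) →
            ¬ Cross (ω n) u v u′ v′ × ¬ ShareEndpoint u v u′ v′
separated u v u′ v′ d (inj₁ (s , _))         = contradiction (same⇒sameEdge s) d
separated u v u′ v′ d (inj₂ (inj₁ (_ , ss))) =
  noCross {u = u} {v} {u′} {v′} (ss refl) , disjoint {u = u} {v} {u′} {v′} (ss refl)
separated {n} u v u′ v′ d (inj₂ (inj₂ (_ , ss))) =
  noCross {u = u′} {v′} {u} {v} (ss refl) ∘ cross-sym {us = ω n} {u} {v} {u′} {v′} ,
  disjoint {u = u′} {v′} {u} {v} (ss refl) ∘ shareEndpoint-sym

-- No edge is distinct from itself, so only the case of a single list entry remains. This gives the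
-- uniqueness in `oneColor`.
comparison-reflexive : ∀ {x y p q} → Comparison x p q y p q → x ≡ y
comparison-reflexive (inj₁ (_ , x≡y))      = x≡y
comparison-reflexive (inj₂ (inj₁ (d , _))) = contradiction (inj₁ (refl , refl)) d
comparison-reflexive (inj₂ (inj₂ (d , _))) = contradiction (inj₁ (refl , refl)) d

-- Degrees and colors

maxDegree≡ : ∀ {n} (G : Graph n) k → (∀ u → Graph.degree G u ≤ k) → ∀ u → k ≤ Graph.degree G u →
             Graph.maxDegree G ≡ k
maxDegree≡ {n} G k degree≤ u ≤degree = ℕ.≤-antisym
  (max≤v⁺ z≤n (All.map⁺ (All.universal degree≤ (allFin n))))
  (v≤max⁺ 0 (map (Graph.degree G) (allFin n)) (inj₂ (Any.map⁺ (lose (∈-allFin u) ≤degree))))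

lookup-injective : ∀ {A : Set} {xs : List A} → Unique xs → ∀ {i j} → lookup xs i ≡ lookup xs j → i ≡ j
lookup-injective (x∉ ∷ _) {zero}  {zero}  eq = refl
lookup-injective (x∉ ∷ _) {zero}  {suc j} eq = contradiction eq (All.lookup x∉ (∈-lookup j))
lookup-injective (x∉ ∷ _) {suc i} {zero}  eq = contradiction (sym eq) (All.lookup x∉ (∈-lookup i))
lookup-injective (_ ∷ us) {suc i} {suc j} eq = cong suc (lookup-injective us eq)

-- The pigeonhole principle behind both degree bounds: `Fin k` holds the four offsets for the upper
-- bound and the places in the list of neighbors for the lower one. Both are read off a membership
-- proof, hence the domain of `f`.
unique-length≤ : ∀ {A : Set} {xs : List A} {k} → Unique xs → (f : ∀ {x} → x ∈ xs → Fin k) →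
  (∀ {x y} (x∈ : x ∈ xs) (y∈ : y ∈ xs) → f x∈ ≡ f y∈ → x ≡ y) → length xs ≤ k
unique-length≤ {xs = xs} us f inj =
  Fin.injective⇒≤ {f = λ i → f (∈-lookup {xs = xs} i)} (λ eq → lookup-injective us (inj _ _ eq))

fromVertex : ∀ k p → index p < k → ∃ λ (u : Fin (k * 2)) → V u ≡ p
fromVertex k p p<k = fromℕ< pred< , trans (cong vertex (Fin.toℕ-fromℕ< pred<)) (vertex-num p)
  where
  pred<′ : ∀ p → index p < k → ℕ.pred (num p) < k * 2
  pred<′ (O i) i<k = ℕ.*-monoˡ-< 2 i<k
  pred<′ (E i) i<k = ℕ.*-monoˡ-≤ 2 i<k
  pred< = pred<′ p p<k

module _ (m : ℕ) (8≤n : 8 ≤ 8 + m * 2) where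
  private
    n = 8 + m * 2
    S : List ℕ
    S = 2 ∷ 3 ∷ []
    G : Graph n
    G = C[ n ,2-3] 8≤n

  2≤n : 2 ≤ n
  2≤n = s≤s (s≤s z≤n)

  3≤n : 3 ≤ n
  3≤n = s≤s (s≤s (s≤s z≤n))

  adj⇒adjacent : ∀ u v → Graph.Adj G u v → Adjacent m (V u) (V v)
  adj⇒adjacent u v (here s) =
    here (Sum.map (step⇒arc m S u v 2≤n) (step⇒arc m S v u 2≤n) s)
  adj⇒adjacent u v (there (here s)) =
    there (here (Sum.map (step⇒arc m S u v 3≤n) (step⇒arc m S v u 3≤n) s))

  adjacent⇒adj : ∀ u v → Adjacent m (V u) (V v) → Graph.Adj G u v
  adjacent⇒adj u v = Any.map (Sum.map (arc⇒step m S u v) (arc⇒step m S v u))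

  Neighbor : Fin 4 → Fin n → Fin n → Set
  Neighbor zero                   u v = Step n S u v 2
  Neighbor (suc zero)             u v = Step n S v u 2
  Neighbor (suc (suc zero))       u v = Step n S u v 3
  Neighbor (suc (suc (suc zero))) u v = Step n S v u 3

  neighbor-unique : ∀ t u v w → Neighbor t u v → Neighbor t u w → v ≡ w
  neighbor-unique zero                   u v w = step-functional m S u v w 2≤n
  neighbor-unique (suc zero)             u v w = step-injective m S u v w 2≤n
  neighbor-unique (suc (suc zero))       u v w = step-functional m S u v w 3≤n
  neighbor-unique (suc (suc (suc zero))) u v w = step-injective m S u v w 3≤n

  adj⇒neighbor : ∀ {u v} → Graph.Adj G u v → ∃ λ t → Neighbor t u v
  adj⇒neighbor (here (inj₁ s))         = zero , s
  adj⇒neighbor (here (inj₂ s))         = suc zero , s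
  adj⇒neighbor (there (here (inj₁ s))) = suc (suc zero) , s
  adj⇒neighbor (there (here (inj₂ s))) = suc (suc (suc zero)) , s

  degree≤4 : ∀ u → Graph.degree G u ≤ 4
  degree≤4 u = unique-length≤ (Unique.filter⁺ (Graph.adj? G u) (Unique.allFin⁺ n)) (proj₁ ∘ neighbor)
    (λ {v} {w} v∈ w∈ eq → neighbor-unique (proj₁ (neighbor w∈)) u v w
      (subst (λ t → Neighbor t u v) eq (proj₂ (neighbor v∈))) (proj₂ (neighbor w∈)))
    where
    neighbor : ∀ {v} → v ∈ filter (Graph.adj? G u) (allFin n) → ∃ λ t → Neighbor t u v
    neighbor {v} v∈ = adj⇒neighbor {u} {v} (proj₂ (∈-filter⁻ (Graph.adj? G u) {xs = allFin n} v∈))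

  -- Vertex 4 is the smallest from which all four offsets stay between 1 and n. Its neighbors 1, 2,
  -- 6, 7 involve no wrap, so each congruence computes to `n ∣ 0`.
  4≤degree : 4 ≤ Graph.degree G (suc (suc (suc zero)))
  4≤degree = unique-length≤ {xs = neighbors} distinct (λ v∈ → Any.index (listed v∈))
    (λ v∈ w∈ → Membership.index-injective (setoid (Fin n)) (listed v∈) (listed w∈))
    where
    u : Fin n
    u = suc (suc (suc zero))
    neighbors : List (Fin n)
    neighbors = zero ∷ suc zero
              ∷ suc (suc (suc (suc (suc zero)))) ∷ suc (suc (suc (suc (suc (suc zero))))) ∷ []
    distinct : Unique neighbors
    distinct = ((λ ()) ∷ (λ ()) ∷ (λ ()) ∷ []) ∷ ((λ ()) ∷ (λ ()) ∷ []) ∷ ((λ ()) ∷ []) ∷ [] ∷ []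
    adjacent : All (Graph.Adj G u) neighbors
    adjacent = there (here (inj₂ (n ∣0))) ∷ here (inj₂ (n ∣0))
             ∷ here (inj₁ (n ∣0)) ∷ there (here (inj₁ (n ∣0))) ∷ []
    listed : ∀ {v} → v ∈ neighbors → v ∈ filter (Graph.adj? G u) (allFin n)
    listed v∈ = ∈-filter⁺ (Graph.adj? G u) (∈-allFin _) (All.lookup adjacent v∈)

  maxDegree≡4 : Graph.maxDegree G ≡ 4
  maxDegree≡4 = maxDegree≡ G 4 degree≤4 (suc (suc (suc zero))) 4≤degree

  -- The embedding and its five colors

  module _ (rf : Bool) where
    private
      x = first rf
      y = second rf

    compareEdges : ∀ {z w u v u′ v′} → c n rf z u v → c n rf w u′ v′ →
                   Comparison z (V u) (V v) w (V u′) (V v′)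
    compareEdges {z} {w} {u} {v} {u′} {v′} e f =
      compare m (first-pathColor rf) (second-pathColor rf) (first≢second rf)
        (c⇒joined m rf {z} {u} {v} e) (c⇒joined m rf {w} {u′} {v′} f)

    isEdgeColoring : IsEdgeColoring G (c n rf)
    isEdgeColoring = record
      { onEdges    = λ {z} {u} {v} e → joined⇒adj {z} {u} {v} (c⇒joined m rf {z} {u} {v} e)
      ; undirected = Sum.swap
      ; oneColor   = λ {u} {v} → uniquelyColored u v
      }
      where
      edge⇒adj : ∀ {z u v} → (z , V u , V v) ∈ edges m x y → Graph.Adj G u v
      edge⇒adj {u = u} {v} e =
        adjacent⇒adj u v (All.lookup (edges-adjacent m (first-pathColor rf) (second-pathColor rf)) e)
      joined⇒adj : ∀ {z u v} → Joined m x y z (V u) (V v) → Graph.Adj G u v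
      joined⇒adj {z} {u} {v} (inj₁ e) = edge⇒adj {z} {u} {v} e
      joined⇒adj {z} {u} {v} (inj₂ e) = Graph.symm G {v} {u} (edge⇒adj {z} {v} {u} e)
      uniquelyColored : ∀ u v → Graph.Adj G u v → ∃! _≡_ (λ z → c n rf z u v)
      uniquelyColored u v a =
        color (adjacent⇒joined m x y (V-index< (4 + m) u) (V-index< (4 + m) v) (adj⇒adjacent u v a))
        where
        color : (∃ λ z → Joined m x y z (V u) (V v)) → ∃! _≡_ (λ z → c n rf z u v)
        color (z , j) = z , e , λ {w} f → comparison-reflexive (compareEdges {z} {w} {u} {v} {u} {v} e f)
          where
          e : c n rf z u v
          e = joined⇒c m rf {z} {u} {v} j

    isMatchingBookEmbedding : IsMatchingBookEmbedding G (ω n) (c n rf)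
    isMatchingBookEmbedding = record
      { cyclicOrder  = ω-↭ n
      ; edgeColoring = isEdgeColoring
      ; noCrossing   = λ {z} {u} {v} {u′} {v′} → uncrossed {z} {u} {v} {u′} {v′}
      ; matching     = λ {z} {u} {v} {u′} {v′} → matched {z} {u} {v} {u′} {v′}
      }
      where
      uncrossed : ∀ {z u v u′ v′} → c n rf z u v → c n rf z u′ v′ →
                  ¬ SameEdge u v u′ v′ → ¬ Cross (ω n) u v u′ v′
      uncrossed {z} {u} {v} {u′} {v′} e f d =
        proj₁ (separated u v u′ v′ d (compareEdges {z} {z} {u} {v} {u′} {v′} e f))
      matched : ∀ {z u v u′ v′} → c n rf z u v → c n rf z u′ v′ →
                ¬ SameEdge u v u′ v′ → ¬ ShareEndpoint u v u′ v′
      matched {z} {u} {v} {u′} {v′} e f d =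
        proj₂ (separated u v u′ v′ d (compareEdges {z} {z} {u} {v} {u′} {v′} e f))

    colors : List Color
    colors = red ∷ black ∷ purple ∷ blue ∷ green ∷ []

    used : ∀ {z p q} → index p < 4 + m → index q < 4 + m → (z , p , q) ∈ edges m x y → ∃₂ (c n rf z)
    used {z} {p} {q} p< q< e with fromVertex (4 + m) p p< | fromVertex (4 + m) q q<
    ... | u , refl | v , refl = u , v , joined⇒c m rf {z} {u} {v} (inj₁ e)

    -- The witnesses for the two path colors are the first two edges of the path, from n - 3 to n -
    -- 5 and on to n - 7.
    first-used : ∃₂ (c n rf (first rf))
    first-used = used (ℕ.m<n+m (2 + m) {2} z<s) (ℕ.m<n+m (1 + m) {3} z<s) (here refl)

    second-used : ∃₂ (c n rf (second rf))
    second-used = used (ℕ.m<n+m (1 + m) {3} z<s) (ℕ.m<n+m m {4} z<s) (there (here refl))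

    numberOfColors≡5 : NumberOfColors (c n rf) 5
    numberOfColors≡5 =
      colors , distinct , (λ z → mk⇔ (λ _ → color-used rf first-used second-used z) (λ _ → ∈-colors z)) , refl
      where
      distinct : Unique colors
      distinct = ((λ ()) ∷ (λ ()) ∷ (λ ()) ∷ (λ ()) ∷ []) ∷ ((λ ()) ∷ (λ ()) ∷ (λ ()) ∷ [])
               ∷ ((λ ()) ∷ (λ ()) ∷ []) ∷ ((λ ()) ∷ []) ∷ [] ∷ []
      ∈-colors : ∀ z → z ∈ colors
      ∈-colors red    = here refl
      ∈-colors black  = there (here refl)
      ∈-colors purple = there (there (here refl))
      ∈-colors blue   = there (there (there (here refl)))
      ∈-colors green  = there (there (there (there (here refl))))
      color-used : ∀ b → ∃₂ (c n rf (first b)) → ∃₂ (c n rf (second b)) → ∀ z → ∃₂ (c n rf z)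
      color-used true  r b red    = r
      color-used true  r b black  = b
      color-used false b r red    = r
      color-used false b r black  = b
      color-used _     _ _ purple = used z<s (s<s (s<s z<s)) (purple∈edges m x y z<s)
      color-used _     _ _ blue   = used z<s (s<s z<s) (blue∈edges m x y z<s)
      color-used _     _ _ green  = used z<s (s<s z<s) (green∈edges m x y (here refl))

    isNearlyDispersable : IsNearlyDispersable G (ω n) (c n rf)
    isNearlyDispersable = record
      { matchingBookEmbedding = isMatchingBookEmbedding
      ; numberOfColors        = subst (NumberOfColors (c n rf)) (cong (1 +_) (sym maxDegree≡4)) numberOfColors≡5
      }

theorem4 : (n : ℕ) (8≤n : 8 ≤ n) → 2 ∣ n → (redFirst : Bool) →
    IsNearlyDispersable (C[ n ,2-3] 8≤n) (ω n) (c n redFirst)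
-- The quotient 4 + m makes n equal to (4 + m) * 2, which computes to 8 + m * 2. Smaller quotients
-- contradict 8 ≤ n.
theorem4 _ 8≤n (divides (suc (suc (suc (suc m)))) refl) = isNearlyDispersable m 8≤n
theorem4 _ () (divides 0 refl)
theorem4 _ (s≤s (s≤s ())) (divides 1 refl)
theorem4 _ (s≤s (s≤s (s≤s (s≤s ())))) (divides 2 refl)
theorem4 _ (s≤s (s≤s (s≤s (s≤s (s≤s (s≤s ())))))) (divides 3 refl)
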